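{- For integers $m\ge 5$ and $b$ with $3\le b\le \frac{5m-16}{3}$ and $b\equiv m\pmod 2$, let $$f(5,m,b)(q)=\binom{m}{5}_q-q^{\frac{5m-3b-16}{2}}\binom{b}{3}_q .$$ Then for all sufficiently large $m$, the polynomial $f(5,m,b)$ is nonnegative and unimodal for every such $b$, with the only exception of $b=\frac{5m-18}{3}$ when this is an integer (i.e., when $3$ divides $2m-6$), in which case $f(5,m,b)$ is not both nonnegative and unimodal.
   Context: For integers $m\ge k\ge 0$ the $q$-binomial coefficient is $\binom{m}{k}_q=\prod_{i=1}^{m}(1-q^i)\big/\big(\prod_{i=1}^{k}(1-q^i)\prod_{i=1}^{m-k}(1-q^i)\big)$. A polynomial is nonnegative if all its coefficients are $\ge 0$, and unimodal if its coefficient sequence weakly increases up to some index and weakly decreases afterwards. -}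

module Defs where

open import Data.Nat as ℕ using (ℕ; zero; suc; _∸_; _≡ᵇ_; _≤ᵇ_; _%_; ⌊_/2⌋)
open import Data.Integer as ℤ using (ℤ; _+_; _-_; _*_; _≤_; 0ℤ; 1ℤ)
open import Data.Bool using (if_then_else_)
open import Data.Product using (∃; _×_)

-- Formal power series / polynomials over ℤ, as coefficient sequences.
Series : Set
Series = ℕ → ℤ

Σ≤ : ℕ → (ℕ → ℤ) → ℤ
Σ≤ zero    f = f 0
Σ≤ (suc n) f = Σ≤ n f + f (suc n)

_⊛_ : Series → Series → Series
(a ⊛ b) n = Σ≤ n (λ j → a j * b (n ∸ j))

infixl 7 _⊛_

_⊖_ : Series → Series → Series
(a ⊖ b) n = a n - b n

oneS : Series
oneS n = if n ≡ᵇ 0 then 1ℤ else 0ℤ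

oneMinusQ : ℕ → Series
oneMinusQ i n = (if n ≡ᵇ 0 then 1ℤ else 0ℤ) - (if n ≡ᵇ i then 1ℤ else 0ℤ)

-- (1 - q^(suc i))⁻¹ = Σ_k q^(k (suc i)), as a power series
invOneMinusQ : ℕ → Series
invOneMinusQ i n = if (n % suc i) ≡ᵇ 0 then 1ℤ else 0ℤ

qPoch : ℕ → Series
qPoch zero    = oneS
qPoch (suc m) = qPoch m ⊛ oneMinusQ (suc m)

qPochInv : ℕ → Series
qPochInv zero    = oneS
qPochInv (suc m) = qPochInv m ⊛ invOneMinusQ m

-- q-binomial coefficient by the product formula
-- binom m k = ∏_{i≤m}(1-q^i) / (∏_{i≤k}(1-q^i) ∏_{i≤m-k}(1-q^i))   (for k ≤ m)
qBinom : ℕ → ℕ → Series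
qBinom m k = qPoch m ⊛ qPochInv k ⊛ qPochInv (m ∸ k)

shiftQ : ℕ → Series → Series
shiftQ s a n = if s ≤ᵇ n then a (n ∸ s) else 0ℤ

f5 : ℕ → ℕ → Series
f5 m b = qBinom m 5 ⊖ shiftQ ⌊ (5 ℕ.* m ∸ 3 ℕ.* b ∸ 16) /2⌋ (qBinom b 3)

Nonnegative : Series → Set
Nonnegative a = ∀ n → 0ℤ ≤ a n

Unimodal : Series → Set
Unimodal a = ∃ λ t →
  (∀ i j → i ℕ.≤ j → j ℕ.≤ t → a i ≤ a j) ×
  (∀ i j → t ℕ.≤ i → i ℕ.≤ j → a j ≤ a i)

{-# OPTIONS --safe #-}
module Submission where

-- Put N = m − 5, B = b − 3 and 2s = 5N − 3B. Both q-binomials are palindromic about the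
-- same centre 5N/2 (Pascal's rule in its two forms), so it suffices that the coefficients of
-- (1 − q) f5 are nonnegative in degrees ≤ 5N/2. There (1 − q) binom(b, 3) is at most
-- T = 1/((1−q²)(1−q³)), and T(n − s) ≤ T(n) unless s = 1, because every s ≠ 1 is a sum of
-- twos and threes; for s = 1 the coefficients of f5 begin 1, 0, 1. Expanding the numerator,
-- (1 − q) binom(m, 5) has coefficients P(n) − Q(n−N−1) + R(n−2N−3), where P, Q, R count
-- partitions with parts 2345, 1234, 1223. These are cubics in n up to a linear error, and the
-- resulting cubic in n is of order at least N² for N < n ≤ 5N/2, whereas T is linear.

open import Defs
open import Algebra.Solver.Ring.AlmostCommutativeRing using (AlmostCommutativeRing; _-Raw-AlmostCommutative⟶_)
open import Algebra.Structures.Biased using (isCommutativeSemiringˡ)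
open import Data.Bool using (if_then_else_)
open import Data.Empty using (⊥-elim)
open import Data.Integer as ℤ using (ℤ; 0ℤ; 1ℤ)
import Data.Integer.Properties as ℤ
import Data.Integer.Tactic.RingSolver as ℤSolver
open import Data.Maybe.Base using (Maybe; just; nothing)
open import Data.Nat using (ℕ; zero; suc; _+_; _*_; _∸_; _/_; _%_; ⌊_/2⌋; _≤_; _<_; z≤n; s≤s; _≤?_; _≡ᵇ_; _≤ᵇ_)
open import Data.Nat.Divisibility as ℕ using (_∣_; divides)
import Data.Nat.DivMod as ℕ
open import Data.Nat.Induction using (<-rec)
import Data.Nat.Properties as ℕ
open import Data.Nat.Tactic.RingSolver using (solve-∀)
open import Data.Product using (∃; _×_; _,_; proj₁; proj₂)
open import Data.Sum using (inj₁; inj₂)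
open import Level using (0ℓ)
open import Relation.Binary.PropositionalEquality using (_≡_; _≢_; refl; sym; trans; cong; cong₂; subst; subst₂; module ≡-Reasoning)
open import Relation.Binary.Structures using (IsEquivalence)
open import Relation.Nullary using (¬_; yes; no)
open import Relation.Nullary.Decidable using (toWitness)

-- The counts are compared with cubes of n plus half the sum of the parts. About that centre the
-- polynomial part of such a count has a fixed parity, so the cube alone accounts for the quadratic
-- term, and the leading coefficients are 1/720, 1/144 and 1/72 for parts 2345, 1234 and 1223. That
-- the errors are only linear is essential: next to the middle degree 5N/2 the main term of P - Q +
-- R degenerates to order N², so a quadratic error could swallow it. After multiplication by 720 the
-- accumulated linear errors, including T, stay below 1000 (N + 3), and `1000 ≤ N` makes this at
-- most (N + 3)². This is the only origin of the threshold. The particular parts in Q and R come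
-- from cancellation: the first two elementary symmetric functions of 1, q, ..., q⁴ are divisible by
-- 1 + q + ... + q⁴, and the second also by 1 + q², so dividing by the denominator merely exchanges
-- the part 5 for 1 and the part 4 for 2.

-- Partition counts with few small parts.

-- partsD n is the number of partitions of n into parts from the multiset D of digits.
-- The part 4 (or the second 2) is added last: no root of unity other than 1 is a zero of
-- two of the other factors 1 − qᵏ, so before this step the count is quadratic up to a
-- bounded error, and the last summation turns this into a cubic with a linear error.
parts2 : ℕ → ℕ
parts2 0             = 1
parts2 1             = 0
parts2 (suc (suc n)) = parts2 n

parts23 : ℕ → ℕ
parts23 0                   = 1
parts23 1                   = 0
parts23 2                   = 1
parts23 (suc (suc (suc n))) = parts23 n + parts2 (3 + n)

parts235 : ℕ → ℕ
parts235 (suc (suc (suc (suc (suc n))))) = parts235 n + parts23 (5 + n)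
parts235 n                               = parts23 n

parts2345 : ℕ → ℕ
parts2345 (suc (suc (suc (suc n)))) = parts2345 n + parts235 (4 + n)
parts2345 n                         = parts235 n

parts12 : ℕ → ℕ
parts12 0             = 1
parts12 1             = 1
parts12 (suc (suc n)) = parts12 n + 1

parts123 : ℕ → ℕ
parts123 (suc (suc (suc n))) = parts123 n + parts12 (3 + n)
parts123 n                   = parts12 n

parts1234 : ℕ → ℕ
parts1234 (suc (suc (suc (suc n)))) = parts1234 n + parts123 (4 + n)
parts1234 n                         = parts123 n

parts1223 : ℕ → ℕ
parts1223 (suc (suc n)) = parts1223 n + parts123 (2 + n)
parts1223 n             = parts123 n

-- The base is a bounded quantifier, so that the finitely many initial values can be discharged by
-- evaluating a decision procedure.
step-induction : ∀ k (P : ℕ → Set) → (∀ {n} → n < suc k → P n) →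
  (∀ n → P n → P (suc k + n)) → ∀ n → P n
step-induction k P base step = <-rec P go
  where
  go : ∀ n → (∀ {i} → i < n → P i) → P n
  go n rec with ℕ.<-≤-connex n (suc k)
  ... | inj₁ n≤k = base n≤k
  ... | inj₂ k<n with ℕ.m≤n⇒∃[o]m+o≡n k<n
  ...   | l , refl = step l (rec (s≤s (ℕ.m≤n+m l k)))

-- Quasi-periodicity of the counts.

parts2-consecutive : ∀ n → parts2 n + parts2 (1 + n) ≡ 1
parts2-consecutive zero    = refl
parts2-consecutive (suc n) = trans (ℕ.+-comm (parts2 (suc n)) (parts2 n)) (parts2-consecutive n)

parts23-periodic : ∀ n → parts23 (6 + n) ≡ 1 + parts23 n
parts23-periodic n = begin
  parts23 n + parts2 (1 + n) + parts2 n     ≡⟨ rearrange (parts23 n) (parts2 (1 + n)) (parts2 n) ⟩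
  (parts2 n + parts2 (1 + n)) + parts23 n   ≡⟨ cong (_+ parts23 n) (parts2-consecutive n) ⟩
  1 + parts23 n                             ∎
  where
  open ≡-Reasoning
  rearrange : ∀ x y z → x + y + z ≡ (z + y) + x
  rearrange = solve-∀

-- Six consecutive arguments meet every residue class modulo 6 once, so the periodic fluctuation
-- drops out and the sum is exactly linear.
parts23-window : ∀ n →
  parts23 n + parts23 (1 + n) + parts23 (2 + n) + parts23 (3 + n) + parts23 (4 + n) + parts23 (5 + n) ≡ 5 + n
parts23-window zero    = refl
parts23-window (suc n) = begin
  b + c + d + e + f + parts23 (6 + n)   ≡⟨ cong (b + c + d + e + f +_) (parts23-periodic n) ⟩
  b + c + d + e + f + (1 + a)           ≡⟨ rearrange a b c d e f ⟩
  1 + (a + b + c + d + e + f)           ≡⟨ cong suc (parts23-window n) ⟩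
  6 + n                                 ∎
  where
  open ≡-Reasoning
  a b c d e f : ℕ
  a = parts23 n
  b = parts23 (1 + n)
  c = parts23 (2 + n)
  d = parts23 (3 + n)
  e = parts23 (4 + n)
  f = parts23 (5 + n)
  rearrange : ∀ a b c d e f → b + c + d + e + f + (1 + a) ≡ 1 + (a + b + c + d + e + f)
  rearrange = solve-∀

-- Unfolding the recurrence six times samples `parts23` at steps of 5. Since 5 is -1 modulo 6, the
-- samples meet each residue class once and reduce to one window.
parts235-periodic : ∀ n → parts235 (30 + n) ≡ parts235 n + (20 + n)
parts235-periodic n = begin
  parts235 n + parts23 (5 + n) + parts23 (10 + n) + parts23 (15 + n) + parts23 (20 + n) + parts23 (25 + n) + parts23 (30 + n)
    ≡⟨ cong₂ (λ u v → parts235 n + parts23 (5 + n) + u + v + parts23 (20 + n) + parts23 (25 + n) + parts23 (30 + n))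
         (parts23-periodic (4 + n)) (+6s 2 (3 + n)) ⟩
  parts235 n + parts23 (5 + n) + (1 + parts23 (4 + n)) + (2 + parts23 (3 + n)) + parts23 (20 + n) + parts23 (25 + n) + parts23 (30 + n)
    ≡⟨ cong₂ (λ u v → parts235 n + parts23 (5 + n) + (1 + parts23 (4 + n)) + (2 + parts23 (3 + n)) + u + v + parts23 (30 + n))
         (+6s 3 (2 + n)) (+6s 4 (1 + n)) ⟩
  parts235 n + parts23 (5 + n) + (1 + parts23 (4 + n)) + (2 + parts23 (3 + n)) + (3 + parts23 (2 + n)) + (4 + parts23 (1 + n)) + parts23 (30 + n)
    ≡⟨ cong (parts235 n + parts23 (5 + n) + (1 + parts23 (4 + n)) + (2 + parts23 (3 + n)) + (3 + parts23 (2 + n)) + (4 + parts23 (1 + n)) +_) (+6s 5 n) ⟩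
  parts235 n + parts23 (5 + n) + (1 + parts23 (4 + n)) + (2 + parts23 (3 + n)) + (3 + parts23 (2 + n)) + (4 + parts23 (1 + n)) + (5 + parts23 n)
    ≡⟨ rearrange (parts235 n) (parts23 n) (parts23 (1 + n)) (parts23 (2 + n)) (parts23 (3 + n)) (parts23 (4 + n)) (parts23 (5 + n)) ⟩
  parts235 n + (15 + (parts23 n + parts23 (1 + n) + parts23 (2 + n) + parts23 (3 + n) + parts23 (4 + n) + parts23 (5 + n)))
    ≡⟨ cong (λ u → parts235 n + (15 + u)) (parts23-window n) ⟩
  parts235 n + (20 + n) ∎
  where
  open ≡-Reasoning
  +6s : ∀ k n → parts23 (k * 6 + n) ≡ k + parts23 n
  +6s zero    n = refl
  +6s (suc k) n = trans (parts23-periodic (k * 6 + n)) (cong suc (+6s k n))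
  rearrange : ∀ v a b c d e f → v + f + (1 + e) + (2 + d) + (3 + c) + (4 + b) + (5 + a)
    ≡ v + (15 + (a + b + c + d + e + f))
  rearrange = solve-∀

parts12-consecutive : ∀ n → parts12 n + parts12 (1 + n) ≡ 2 + n
parts12-consecutive zero    = refl
parts12-consecutive (suc n) = trans (rearrange (parts12 (suc n)) (parts12 n)) (cong suc (parts12-consecutive n))
  where
  rearrange : ∀ x y → x + (y + 1) ≡ suc (y + x)
  rearrange = solve-∀

parts123-periodic : ∀ n → parts123 (6 + n) ≡ parts123 n + (6 + n)
parts123-periodic n = trans (rearrange (parts123 n) (parts12 n) (parts12 (1 + n)))
  (cong (λ u → parts123 n + (4 + u)) (parts12-consecutive n))
  where
  rearrange : ∀ k x y → k + (y + 1) + (x + 1 + 1 + 1) ≡ k + (4 + (x + y))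
  rearrange = solve-∀

-- Linear, quadratic and cubic bounds for the counts.

parts23-upper : ∀ n → 6 * parts23 n ≤ 6 + n
parts23-upper = step-induction 5 _
  (toWitness {a? = ℕ.allUpTo? (λ n → 6 * parts23 n ≤? 6 + n) 6} _) step
  where
  step : ∀ n → 6 * parts23 n ≤ 6 + n → 6 * parts23 (6 + n) ≤ 6 + (6 + n)
  step n ih = begin
    6 * parts23 (6 + n)   ≡⟨ cong (6 *_) (parts23-periodic n) ⟩
    6 * (1 + parts23 n)   ≡⟨ ℕ.*-suc 6 (parts23 n) ⟩
    6 + 6 * parts23 n     ≤⟨ ℕ.+-monoʳ-≤ 6 ih ⟩
    6 + (6 + n)           ∎
    where open ℕ.≤-Reasoning

-- Here 60 = 2!·2·3·5, and 5 = (2 + 3 + 5)/2 is the centre that removes the linear term. Both sides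
-- gain 60 (20 + n) when n grows by 30, so the constant has to fit the first thirty values only; 36
-- is attained at n = 1.
parts235-lower : ∀ n → (5 + n) * (5 + n) ≤ 60 * parts235 n + 36
parts235-lower = step-induction 29 _
  (toWitness {a? = ℕ.allUpTo? (λ n → (5 + n) * (5 + n) ≤? 60 * parts235 n + 36) 30} _) step
  where
  square : ∀ n → (35 + n) * (35 + n) ≡ (5 + n) * (5 + n) + 60 * (20 + n)
  square = solve-∀
  rearrange : ∀ v n → 60 * v + 36 + 60 * (20 + n) ≡ 60 * (v + (20 + n)) + 36
  rearrange = solve-∀
  step : ∀ n → (5 + n) * (5 + n) ≤ 60 * parts235 n + 36 → (35 + n) * (35 + n) ≤ 60 * parts235 (30 + n) + 36
  step n ih = begin
    (35 + n) * (35 + n)                    ≡⟨ square n ⟩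
    (5 + n) * (5 + n) + 60 * (20 + n)      ≤⟨ ℕ.+-monoˡ-≤ (60 * (20 + n)) ih ⟩
    60 * parts235 n + 36 + 60 * (20 + n)   ≡⟨ rearrange (parts235 n) n ⟩
    60 * (parts235 n + (20 + n)) + 36      ≡⟨ cong (λ v → 60 * v + 36) (parts235-periodic n) ⟨
    60 * parts235 (30 + n) + 36            ∎
    where open ℕ.≤-Reasoning

parts123-lower : ∀ n → (3 + n) * (3 + n) ≤ 12 * parts123 n + 4
parts123-lower = step-induction 5 _
  (toWitness {a? = ℕ.allUpTo? (λ n → (3 + n) * (3 + n) ≤? 12 * parts123 n + 4) 6} _) step
  where
  square : ∀ n → (9 + n) * (9 + n) ≡ (3 + n) * (3 + n) + 12 * (6 + n)
  square = solve-∀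
  rearrange : ∀ v n → 12 * v + 4 + 12 * (6 + n) ≡ 12 * (v + (6 + n)) + 4
  rearrange = solve-∀
  step : ∀ n → (3 + n) * (3 + n) ≤ 12 * parts123 n + 4 → (9 + n) * (9 + n) ≤ 12 * parts123 (6 + n) + 4
  step n ih = begin
    (9 + n) * (9 + n)                    ≡⟨ square n ⟩
    (3 + n) * (3 + n) + 12 * (6 + n)     ≤⟨ ℕ.+-monoˡ-≤ (12 * (6 + n)) ih ⟩
    12 * parts123 n + 4 + 12 * (6 + n)   ≡⟨ rearrange (parts123 n) n ⟩
    12 * (parts123 n + (6 + n)) + 4      ≡⟨ cong (λ v → 12 * v + 4) (parts123-periodic n) ⟨
    12 * parts123 (6 + n) + 4            ∎
    where open ℕ.≤-Reasoning

parts123-upper : ∀ n → 12 * parts123 n ≤ (3 + n) * (3 + n) + 3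
parts123-upper = step-induction 5 _
  (toWitness {a? = ℕ.allUpTo? (λ n → 12 * parts123 n ≤? (3 + n) * (3 + n) + 3) 6} _) step
  where
  square : ∀ n → (3 + n) * (3 + n) + 3 + 12 * (6 + n) ≡ (9 + n) * (9 + n) + 3
  square = solve-∀
  step : ∀ n → 12 * parts123 n ≤ (3 + n) * (3 + n) + 3 → 12 * parts123 (6 + n) ≤ (9 + n) * (9 + n) + 3
  step n ih = begin
    12 * parts123 (6 + n)                  ≡⟨ cong (12 *_) (parts123-periodic n) ⟩
    12 * (parts123 n + (6 + n))            ≡⟨ ℕ.*-distribˡ-+ 12 (parts123 n) (6 + n) ⟩
    12 * parts123 n + 12 * (6 + n)         ≤⟨ ℕ.+-monoˡ-≤ (12 * (6 + n)) ih ⟩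
    (3 + n) * (3 + n) + 3 + 12 * (6 + n)   ≡⟨ square n ⟩
    (9 + n) * (9 + n) + 3                  ∎
    where open ℕ.≤-Reasoning

cube : ℕ → ℕ
cube n = n * n * n

-- Here 720 = 3!·2·3·4·5 and 7 = (2 + 3 + 4 + 5)/2. A step of 4 loses 12·36 + 16 = 4·112, which is
-- the slope; 400 makes n = 1 an equality.
parts2345-lower : ∀ n → cube (7 + n) ≤ 720 * parts2345 n + (112 * n + 400)
parts2345-lower = step-induction 3 _
  (toWitness {a? = ℕ.allUpTo? (λ n → cube (7 + n) ≤? 720 * parts2345 n + (112 * n + 400)) 4} _) step
  where
  expand : ∀ n → (11 + n) * (11 + n) * (11 + n) ≡ (7 + n) * (7 + n) * (7 + n) + 12 * ((9 + n) * (9 + n)) + 16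
  expand = solve-∀
  collect : ∀ p v n → 720 * p + (112 * n + 400) + 12 * (60 * v + 36) + 16
    ≡ 720 * (p + v) + (112 * (4 + n) + 400)
  collect = solve-∀
  step : ∀ n → cube (7 + n) ≤ 720 * parts2345 n + (112 * n + 400) →
    cube (11 + n) ≤ 720 * parts2345 (4 + n) + (112 * (4 + n) + 400)
  step n ih = begin
    cube (11 + n)
      ≡⟨ expand n ⟩
    cube (7 + n) + 12 * ((9 + n) * (9 + n)) + 16
      ≤⟨ ℕ.+-monoˡ-≤ 16 (ℕ.+-mono-≤ ih (ℕ.*-monoʳ-≤ 12 (parts235-lower (4 + n)))) ⟩
    720 * parts2345 n + (112 * n + 400) + 12 * (60 * parts235 (4 + n) + 36) + 16
      ≡⟨ collect (parts2345 n) (parts235 (4 + n)) n ⟩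
    720 * parts2345 (4 + n) + (112 * (4 + n) + 400) ∎
    where open ℕ.≤-Reasoning

-- Here 144 = 3!·1·2·3·4 and 5 = (1 + 2 + 3 + 4)/2. A step of 4 costs 12·3 - 16 = 4·5, which is the
-- slope; 19 makes n = 0 an equality.
parts1234-upper : ∀ n → 144 * parts1234 n ≤ cube (5 + n) + (5 * n + 19)
parts1234-upper = step-induction 3 _
  (toWitness {a? = ℕ.allUpTo? (λ n → 144 * parts1234 n ≤? cube (5 + n) + (5 * n + 19)) 4} _) step
  where
  distribute : ∀ x y → 144 * (x + y) ≡ 144 * x + 12 * (12 * y)
  distribute = solve-∀
  expand : ∀ n → (5 + n) * (5 + n) * (5 + n) + (5 * n + 19) + 12 * ((7 + n) * (7 + n) + 3) ≡ (9 + n) * (9 + n) * (9 + n) + (5 * (4 + n) + 19)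
  expand = solve-∀
  step : ∀ n → 144 * parts1234 n ≤ cube (5 + n) + (5 * n + 19) →
    144 * parts1234 (4 + n) ≤ cube (9 + n) + (5 * (4 + n) + 19)
  step n ih = begin
    144 * parts1234 (4 + n)
      ≡⟨ distribute (parts1234 n) (parts123 (4 + n)) ⟩
    144 * parts1234 n + 12 * (12 * parts123 (4 + n))
      ≤⟨ ℕ.+-mono-≤ ih (ℕ.*-monoʳ-≤ 12 (parts123-upper (4 + n))) ⟩
    cube (5 + n) + (5 * n + 19) + 12 * ((7 + n) * (7 + n) + 3)
      ≡⟨ expand n ⟩
    cube (9 + n) + (5 * (4 + n) + 19) ∎
    where open ℕ.≤-Reasoning

-- Here 72 = 3!·1·2·2·3 and 4 = (1 + 2 + 2 + 3)/2. A step of 2 loses 6·4 + 2 = 2·13, which is the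
-- slope; 40 makes n = 1 an equality.
parts1223-lower : ∀ n → cube (4 + n) ≤ 72 * parts1223 n + (13 * n + 40)
parts1223-lower = step-induction 1 _
  (toWitness {a? = ℕ.allUpTo? (λ n → cube (4 + n) ≤? 72 * parts1223 n + (13 * n + 40)) 2} _) step
  where
  expand : ∀ n → (6 + n) * (6 + n) * (6 + n) ≡ (4 + n) * (4 + n) * (4 + n) + 6 * ((5 + n) * (5 + n)) + 2
  expand = solve-∀
  collect : ∀ r k n → 72 * r + (13 * n + 40) + 6 * (12 * k + 4) + 2 ≡ 72 * (r + k) + (13 * (2 + n) + 40)
  collect = solve-∀
  step : ∀ n → cube (4 + n) ≤ 72 * parts1223 n + (13 * n + 40) →
    cube (6 + n) ≤ 72 * parts1223 (2 + n) + (13 * (2 + n) + 40)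
  step n ih = begin
    cube (6 + n)
      ≡⟨ expand n ⟩
    cube (4 + n) + 6 * ((5 + n) * (5 + n)) + 2
      ≤⟨ ℕ.+-monoˡ-≤ 2 (ℕ.+-mono-≤ ih (ℕ.*-monoʳ-≤ 6 (parts123-lower (2 + n)))) ⟩
    72 * parts1223 n + (13 * n + 40) + 6 * (12 * parts123 (2 + n) + 4) + 2
      ≡⟨ collect (parts1223 n) (parts123 (2 + n)) n ⟩
    72 * parts1223 (2 + n) + (13 * (2 + n) + 40) ∎
    where open ℕ.≤-Reasoning

-- Monotonicity of the counts.

parts23-mono₃ : ∀ j → parts23 j ≤ parts23 (3 + j)
parts23-mono₃ j = ℕ.m≤m+n (parts23 j) (parts2 (3 + j))

parts23-mono₂ : ∀ j → parts23 j ≤ parts23 (2 + j)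
parts23-mono₂ 0                   = ℕ.≤-refl
parts23-mono₂ 1                   = z≤n
parts23-mono₂ 2                   = ℕ.≤-refl
parts23-mono₂ (suc (suc (suc j))) = ℕ.+-monoˡ-≤ (parts2 (3 + j)) (parts23-mono₂ j)

parts23-mono : ∀ s j → s ≢ 1 → parts23 j ≤ parts23 (s + j)
parts23-mono 0                           j _   = ℕ.≤-refl
parts23-mono 1                           j s≢1 = ⊥-elim (s≢1 refl)
parts23-mono 2                           j _   = parts23-mono₂ j
parts23-mono 3                           j _   = parts23-mono₃ j
parts23-mono (suc (suc s@(suc (suc _)))) j _   = ℕ.≤-trans (parts23-mono s j λ ()) (parts23-mono₂ (s + j))

parts23≤parts235 : ∀ n → parts23 n ≤ parts235 n
parts23≤parts235 0 = ℕ.≤-refl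
parts23≤parts235 1 = ℕ.≤-refl
parts23≤parts235 2 = ℕ.≤-refl
parts23≤parts235 3 = ℕ.≤-refl
parts23≤parts235 4 = ℕ.≤-refl
parts23≤parts235 (suc (suc (suc (suc (suc n))))) = ℕ.m≤n+m (parts23 (5 + n)) (parts235 n)

parts235≤parts2345 : ∀ n → parts235 n ≤ parts2345 n
parts235≤parts2345 0 = ℕ.≤-refl
parts235≤parts2345 1 = ℕ.≤-refl
parts235≤parts2345 2 = ℕ.≤-refl
parts235≤parts2345 3 = ℕ.≤-refl
parts235≤parts2345 (suc (suc (suc (suc n)))) = ℕ.m≤n+m (parts235 (4 + n)) (parts2345 n)

parts23≤parts2345 : ∀ n → parts23 n ≤ parts2345 n
parts23≤parts2345 n = ℕ.≤-trans (parts23≤parts235 n) (parts235≤parts2345 n)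

-- The two cubic inequalities.

scaled-upper : ∀ n x → 720 * (parts23 n + parts1234 x) ≤ 5 * cube (5 + x) + (120 * n + 25 * x + 815)
scaled-upper n x = begin
  720 * (parts23 n + parts1234 x)
    ≡⟨ distribute (parts23 n) (parts1234 x) ⟩
  -- All bounds are brought to the denominator of `parts2345`: 720 = 120·6 = 5·144 = 10·72.
  120 * (6 * parts23 n) + 5 * (144 * parts1234 x)
    ≤⟨ ℕ.+-mono-≤ (ℕ.*-monoʳ-≤ 120 (parts23-upper n)) (ℕ.*-monoʳ-≤ 5 (parts1234-upper x)) ⟩
  120 * (6 + n) + 5 * (cube (5 + x) + (5 * x + 19))
    ≡⟨ collect n x (cube (5 + x)) ⟩
  5 * cube (5 + x) + (120 * n + 25 * x + 815) ∎
  where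
  open ℕ.≤-Reasoning
  distribute : ∀ t r → 720 * (t + r) ≡ 120 * (6 * t) + 5 * (144 * r)
  distribute = solve-∀
  collect : ∀ n x c → 120 * (6 + n) + 5 * (c + (5 * x + 19)) ≡ 5 * c + (120 * n + 25 * x + 815)
  collect = solve-∀

-- With L = N + 3 and X = x + 5 the cubic terms are (X + L)³ − 5X³ ≥ L³, as X ≤ L + 3.
middle-range : ∀ N x → 1000 ≤ N → x ≤ 1 + N →
  parts23 (1 + N + x) + parts1234 x ≤ parts2345 (1 + N + x)
middle-range N x 1000≤N x≤1+N = ℕ.*-cancelˡ-≤ 720 (ℕ.+-cancelʳ-≤ (112 * n + 400) _ _ (begin
  720 * (parts23 n + parts1234 x) + (112 * n + 400)
    ≤⟨ ℕ.+-monoˡ-≤ (112 * n + 400) (scaled-upper n x) ⟩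
  5 * cube X + (120 * n + 25 * x + 815) + (112 * n + 400)
    ≡⟨ split N x (X * X) ⟩
  X * X * X + X * X * (4 * X) + (257 * x + 232 * N + 1447)
    ≤⟨ ℕ.+-mono-≤ (ℕ.+-monoʳ-≤ (X * X * X) quadratic) linear ⟩
  X * X * X + (3 * (X * X * L) + 3 * (X * L * L)) + L * L * L
    ≡⟨ binomial N x ⟩
  cube (7 + n)
    ≤⟨ parts2345-lower n ⟩
  720 * parts2345 n + (112 * n + 400) ∎))
  where
  open ℕ.≤-Reasoning
  n X L : ℕ
  n = 1 + N + x
  X = 5 + x
  L = 3 + N
  split : ∀ N x s → 5 * (s * (5 + x)) + (120 * (1 + N + x) + 25 * x + 815) + (112 * (1 + N + x) + 400)
    ≡ s * (5 + x) + s * (4 * (5 + x)) + (257 * x + 232 * N + 1447)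
  split = solve-∀
  binomial : ∀ N x → (5 + x) * (5 + x) * (5 + x) + (3 * ((5 + x) * (5 + x) * (3 + N)) + 3 * ((5 + x) * (3 + N) * (3 + N)))
      + (3 + N) * (3 + N) * (3 + N)
    ≡ (7 + (1 + N + x)) * (7 + (1 + N + x)) * (7 + (1 + N + x))
  binomial = solve-∀
  4X≤5L : 4 * X ≤ 5 * L
  4X≤5L = begin
    4 * (5 + x)         ≤⟨ ℕ.*-monoʳ-≤ 4 (ℕ.+-monoʳ-≤ 5 x≤1+N) ⟩
    4 * (5 + (1 + N))   ≡⟨ regroup₁ N ⟩
    15 + 4 * N + 9      ≤⟨ ℕ.+-monoʳ-≤ (15 + 4 * N) (ℕ.≤-trans (ℕ.m≤m+n 9 991) 1000≤N) ⟩
    15 + 4 * N + N      ≡⟨ regroup₂ N ⟩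
    5 * (3 + N)         ∎
    where
    regroup₁ : ∀ N → 4 * (5 + (1 + N)) ≡ 15 + 4 * N + 9
    regroup₁ = solve-∀
    regroup₂ : ∀ N → 15 + 4 * N + N ≡ 5 * (3 + N)
    regroup₂ = solve-∀
  2X≤3L : 2 * X ≤ 3 * L
  2X≤3L = ℕ.*-cancelˡ-≤ 2 (begin
    2 * (2 * X)   ≡⟨ ℕ.*-assoc 2 2 X ⟨
    4 * X         ≤⟨ 4X≤5L ⟩
    5 * L         ≤⟨ ℕ.*-monoˡ-≤ L (ℕ.m≤m+n 5 1) ⟩
    6 * L         ≡⟨ ℕ.*-assoc 2 3 L ⟩
    2 * (3 * L)   ∎)
  -- This is 4X³ ≤ 3X²L + 3XL². Spending 4X ≤ 5L on one factor leaves 2X²L beyond the first term,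
  -- and 2X ≤ 3L turns this into the second.
  quadratic : X * X * (4 * X) ≤ 3 * (X * X * L) + 3 * (X * L * L)
  quadratic = begin
    X * X * (4 * X)                     ≤⟨ ℕ.*-monoʳ-≤ (X * X) 4X≤5L ⟩
    X * X * (5 * L)                     ≡⟨ regroup₁ X L ⟩
    3 * (X * X * L) + X * L * (2 * X)   ≤⟨ ℕ.+-monoʳ-≤ (3 * (X * X * L)) (ℕ.*-monoʳ-≤ (X * L) 2X≤3L) ⟩
    3 * (X * X * L) + X * L * (3 * L)   ≡⟨ regroup₂ X L ⟩
    3 * (X * X * L) + 3 * (X * L * L)   ∎
    where
    regroup₁ : ∀ X L → X * X * (5 * L) ≡ 3 * (X * X * L) + X * L * (2 * X)
    regroup₁ = solve-∀
    regroup₂ : ∀ X L → 3 * (X * X * L) + X * L * (3 * L) ≡ 3 * (X * X * L) + 3 * (X * L * L)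
    regroup₂ = solve-∀
  linear : 257 * x + 232 * N + 1447 ≤ L * L * L
  linear = begin
    257 * x + 232 * N + 1447                            ≤⟨ ℕ.+-monoˡ-≤ 1447 (ℕ.+-monoˡ-≤ (232 * N) (ℕ.*-monoʳ-≤ 257 x≤1+N)) ⟩
    257 * (1 + N) + 232 * N + 1447                      ≤⟨ ℕ.m≤m+n _ (511 * N + 1296) ⟩
    257 * (1 + N) + 232 * N + 1447 + (511 * N + 1296)   ≡⟨ regroup₁ N ⟩
    1000 * L                                            ≤⟨ ℕ.*-monoˡ-≤ L (ℕ.≤-trans 1000≤N (ℕ.m≤n+m N 3)) ⟩
    L * L                                               ≤⟨ ℕ.m≤m*n (L * L) L ⟩
    L * L * L                                           ∎
    where
    regroup₁ : ∀ N → 257 * (1 + N) + 232 * N + 1447 + (511 * N + 1296) ≡ 1000 * (3 + N)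
    regroup₁ = solve-∀

-- With L = N + 3 and Y = y + 4 the cubic terms are
-- (2L + Y)³ − 5(L + Y)³ + 10Y³ = 3(L − 2Y)(L² + LY − Y²),
-- and L − 2Y = 1 + w is positive exactly on the left half.
upper-range : ∀ y w → 1000 ≤ 6 + 2 * y + w → let N = 6 + 2 * y + w in
  parts23 (3 + 2 * N + y) + parts1234 (2 + N + y) ≤ parts2345 (3 + 2 * N + y) + parts1223 y
upper-range y w 1000≤N = ℕ.*-cancelˡ-≤ 720 (ℕ.+-cancelʳ-≤ (112 * n + 130 * y + 800) _ _ (begin
  720 * (parts23 n + parts1234 x) + (112 * n + 130 * y + 800)
    ≤⟨ ℕ.+-monoˡ-≤ (112 * n + 130 * y + 800) (scaled-upper n x) ⟩
  5 * cube (5 + x) + (120 * n + 25 * x + 815) + (112 * n + 130 * y + 800)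
    ≡⟨ split y w (cube (5 + x)) ⟩
  5 * cube (5 + x) + (1365 * y + 489 * w + 5295)
    ≤⟨ ℕ.+-monoʳ-≤ (5 * cube (5 + x)) linear ⟩
  5 * cube (5 + x) + L * L
    -- Since Z = Y (L - Y), the main term is 3 (1 + w) (L² + Z). One L² has paid for the linear
    -- errors; the summand added here is the rest.
    ≤⟨ ℕ.m≤m+n _ _ ⟩
  5 * cube (5 + x) + L * L + (2 * (L * L) + 3 * Z + 3 * w * (L * L + Z))
    ≡⟨ factor y w ⟩
  cube (7 + n) + 10 * cube (4 + y)
    ≤⟨ ℕ.+-mono-≤ (parts2345-lower n) (ℕ.*-monoʳ-≤ 10 (parts1223-lower y)) ⟩
  720 * parts2345 n + (112 * n + 400) + 10 * (72 * parts1223 y + (13 * y + 40))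
    ≡⟨ collect n y (parts2345 n) (parts1223 y) ⟩
  720 * (parts2345 n + parts1223 y) + (112 * n + 130 * y + 800) ∎))
  where
  open ℕ.≤-Reasoning
  N n x L Z : ℕ
  N = 6 + 2 * y + w
  n = 3 + 2 * N + y
  x = 2 + N + y
  L = 3 + N
  Z = (4 + y) * (5 + y + w)
  split : ∀ y w c → 5 * c + (120 * (3 + 2 * (6 + 2 * y + w) + y) + 25 * (2 + (6 + 2 * y + w) + y) + 815)
      + (112 * (3 + 2 * (6 + 2 * y + w) + y) + 130 * y + 800)
    ≡ 5 * c + (1365 * y + 489 * w + 5295)
  split = solve-∀
  collect : ∀ n y p r → 720 * p + (112 * n + 400) + 10 * (72 * r + (13 * y + 40))
    ≡ 720 * (p + r) + (112 * n + 130 * y + 800)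
  collect = solve-∀
  factor : ∀ y w →
    5 * ((5 + (2 + (6 + 2 * y + w) + y)) * (5 + (2 + (6 + 2 * y + w) + y)) * (5 + (2 + (6 + 2 * y + w) + y)))
      + (3 + (6 + 2 * y + w)) * (3 + (6 + 2 * y + w))
      + (2 * ((3 + (6 + 2 * y + w)) * (3 + (6 + 2 * y + w))) + 3 * ((4 + y) * (5 + y + w))
         + 3 * w * ((3 + (6 + 2 * y + w)) * (3 + (6 + 2 * y + w)) + (4 + y) * (5 + y + w)))
    ≡ (7 + (3 + 2 * (6 + 2 * y + w) + y)) * (7 + (3 + 2 * (6 + 2 * y + w) + y)) * (7 + (3 + 2 * (6 + 2 * y + w) + y))
      + 10 * ((4 + y) * (4 + y) * (4 + y))
  factor = solve-∀
  linear : 1365 * y + 489 * w + 5295 ≤ L * L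
  linear = begin
    1365 * y + 489 * w + 5295                                ≤⟨ ℕ.m≤m+n _ (635 * y + 511 * w + 3705) ⟩
    1365 * y + 489 * w + 5295 + (635 * y + 511 * w + 3705)   ≡⟨ regroup₁ y w ⟩
    1000 * L                                                 ≤⟨ ℕ.*-monoˡ-≤ L (ℕ.≤-trans 1000≤N (ℕ.m≤n+m N 3)) ⟩
    L * L                                                    ∎
    where
    regroup₁ : ∀ y w → 1365 * y + 489 * w + 5295 + (635 * y + 511 * w + 3705) ≡ 1000 * (3 + (6 + 2 * y + w))
    regroup₁ = solve-∀

-- The commutative ring of formal power series.

infix 4 _≈_
infixl 6 _⊕_
infix 8 ⊝_

-- A record rather than a bare pointwise statement, so that unification can read the two series off
-- the type.
record _≈_ (a b : Series) : Set where
  constructor pointwise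
  field at : ∀ n → a n ≡ b n

open _≈_

_⊕_ : Series → Series → Series
(a ⊕ b) n = a n ℤ.+ b n

⊝_ : Series → Series
(⊝ a) n = ℤ.- a n

constS : ℤ → Series
constS x n = if n ≡ᵇ 0 then x else 0ℤ

zeroS : Series
zeroS n = 0ℤ

mono : ℕ → Series
mono k n = if n ≡ᵇ k then 1ℤ else 0ℤ

tail : Series → Series
tail a n = a (suc n)

Σ≤-cong : ∀ n {f g : ℕ → ℤ} → (∀ j → j ≤ n → f j ≡ g j) → Σ≤ n f ≡ Σ≤ n g
Σ≤-cong zero    f≗g = f≗g 0 z≤n
Σ≤-cong (suc n) f≗g = cong₂ ℤ._+_
  (Σ≤-cong n (λ j j≤n → f≗g j (ℕ.m≤n⇒m≤1+n j≤n))) (f≗g (suc n) ℕ.≤-refl)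

Σ≤-+ : ∀ n (f g : ℕ → ℤ) → Σ≤ n (λ j → f j ℤ.+ g j) ≡ Σ≤ n f ℤ.+ Σ≤ n g
Σ≤-+ zero    f g = refl
Σ≤-+ (suc n) f g = trans (cong₂ ℤ._+_ (Σ≤-+ n f g) refl) (interchange (Σ≤ n f) (Σ≤ n g) _ _)
  where
  interchange : ∀ w x y z → w ℤ.+ x ℤ.+ (y ℤ.+ z) ≡ w ℤ.+ y ℤ.+ (x ℤ.+ z)
  interchange = ℤSolver.solve-∀

Σ≤-* : ∀ n x (f : ℕ → ℤ) → Σ≤ n (λ j → x ℤ.* f j) ≡ x ℤ.* Σ≤ n f
Σ≤-* zero    x f = refl
Σ≤-* (suc n) x f = trans (cong₂ ℤ._+_ (Σ≤-* n x f) refl) (sym (ℤ.*-distribˡ-+ x (Σ≤ n f) _))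

Σ≤-zero : ∀ n → Σ≤ n (λ _ → 0ℤ) ≡ 0ℤ
Σ≤-zero zero    = refl
Σ≤-zero (suc n) = cong (ℤ._+ 0ℤ) (Σ≤-zero n)

Σ≤-head : ∀ n (f : ℕ → ℤ) → Σ≤ (suc n) f ≡ f 0 ℤ.+ Σ≤ n (λ j → f (suc j))
Σ≤-head zero    f = refl
Σ≤-head (suc n) f = trans (cong₂ ℤ._+_ (Σ≤-head n f) refl) (ℤ.+-assoc (f 0) _ _)

⊛-suc : ∀ a b n → (a ⊛ b) (suc n) ≡ a 0 ℤ.* b (suc n) ℤ.+ (tail a ⊛ b) n
⊛-suc a b n = Σ≤-head n _

⊛-sucʳ : ∀ a b n → (a ⊛ b) (suc n) ≡ (a ⊛ tail b) n ℤ.+ a (suc n) ℤ.* b 0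
⊛-sucʳ a b n = cong₂ ℤ._+_
  (Σ≤-cong n (λ j j≤n → cong (λ i → a j ℤ.* b i) (ℕ.+-∸-assoc 1 j≤n)))
  (cong (λ i → a (suc n) ℤ.* b i) (ℕ.n∸n≡0 n))

≈-refl : ∀ {a} → a ≈ a
≈-refl = pointwise λ _ → refl

≈-sym : ∀ {a b} → a ≈ b → b ≈ a
≈-sym p = pointwise λ n → sym (at p n)

≈-trans : ∀ {a b c} → a ≈ b → b ≈ c → a ≈ c
≈-trans p q = pointwise λ n → trans (at p n) (at q n)

⊕-cong : ∀ {a b c d} → a ≈ b → c ≈ d → a ⊕ c ≈ b ⊕ d
⊕-cong p q = pointwise λ n → cong₂ ℤ._+_ (at p n) (at q n)

⊛-cong : ∀ {a b c d} → a ≈ b → c ≈ d → a ⊛ c ≈ b ⊛ d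
⊛-cong p q = pointwise λ n → Σ≤-cong n (λ j _ → cong₂ ℤ._*_ (at p j) (at q _))

⊛-congˡ : ∀ {a b} c → a ≈ b → c ⊛ a ≈ c ⊛ b
⊛-congˡ c = ⊛-cong (≈-refl {c})

⊛-congʳ : ∀ {a b} c → a ≈ b → a ⊛ c ≈ b ⊛ c
⊛-congʳ c p = ⊛-cong p (≈-refl {c})

⊛-zeroˡ : ∀ a → zeroS ⊛ a ≈ zeroS
⊛-zeroˡ a = pointwise Σ≤-zero

⊛-distribʳ-⊕ : ∀ a b c → (b ⊕ c) ⊛ a ≈ b ⊛ a ⊕ c ⊛ a
⊛-distribʳ-⊕ a b c = pointwise λ n → trans
  (Σ≤-cong n (λ j _ → ℤ.*-distribʳ-+ (a (n ∸ j)) (b j) (c j)))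
  (Σ≤-+ n _ _)

⊛-scale : ∀ x a b n → ((λ j → x ℤ.* a j) ⊛ b) n ≡ x ℤ.* (a ⊛ b) n
⊛-scale x a b n = trans (Σ≤-cong n (λ j _ → ℤ.*-assoc x (a j) _)) (Σ≤-* n x _)

-- The first summand of one product is the last summand of the other. Peeling both leaves the same
-- claim for `tail a`, so the induction generalises over the series.
⊛-comm : ∀ a b → a ⊛ b ≈ b ⊛ a
⊛-comm a b = pointwise (go a b)
  where
  go : ∀ a b n → (a ⊛ b) n ≡ (b ⊛ a) n
  go a b zero    = ℤ.*-comm (a 0) (b 0)
  go a b (suc n) = begin
    (a ⊛ b) (suc n)                        ≡⟨ ⊛-suc a b n ⟩
    a 0 ℤ.* b (suc n) ℤ.+ (tail a ⊛ b) n   ≡⟨ cong₂ ℤ._+_ (ℤ.*-comm (a 0) _) (go (tail a) b n) ⟩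
    b (suc n) ℤ.* a 0 ℤ.+ (b ⊛ tail a) n   ≡⟨ ℤ.+-comm _ ((b ⊛ tail a) n) ⟩
    (b ⊛ tail a) n ℤ.+ b (suc n) ℤ.* a 0   ≡⟨ ⊛-sucʳ b a n ⟨
    (b ⊛ a) (suc n)                        ∎
    where open ≡-Reasoning

-- The tail behaves like a twisted derivation: the tail of a product ab is a₀ times the tail of b,
-- plus the tail of a times b. The induction therefore passes to `tail a` with b and c fixed.
⊛-assoc : ∀ a b c → (a ⊛ b) ⊛ c ≈ a ⊛ (b ⊛ c)
⊛-assoc a b c = pointwise (go a)
  where
  go : ∀ a n → ((a ⊛ b) ⊛ c) n ≡ (a ⊛ (b ⊛ c)) n
  go a zero    = ℤ.*-assoc (a 0) (b 0) (c 0)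
  go a (suc n) = begin
    ((a ⊛ b) ⊛ c) (suc n)
      ≡⟨ ⊛-suc (a ⊛ b) c n ⟩
    a 0 ℤ.* b 0 ℤ.* c (suc n) ℤ.+ (tail (a ⊛ b) ⊛ c) n
      ≡⟨ cong (λ x → a 0 ℤ.* b 0 ℤ.* c (suc n) ℤ.+ x) tail-step ⟩
    a 0 ℤ.* b 0 ℤ.* c (suc n) ℤ.+ (a 0 ℤ.* (tail b ⊛ c) n ℤ.+ (tail a ⊛ (b ⊛ c)) n)
      ≡⟨ regroup (a 0) (b 0) (c (suc n)) _ _ ⟩
    a 0 ℤ.* (b 0 ℤ.* c (suc n) ℤ.+ (tail b ⊛ c) n) ℤ.+ (tail a ⊛ (b ⊛ c)) n
      ≡⟨ cong (λ x → a 0 ℤ.* x ℤ.+ (tail a ⊛ (b ⊛ c)) n) (⊛-suc b c n) ⟨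
    a 0 ℤ.* (b ⊛ c) (suc n) ℤ.+ (tail a ⊛ (b ⊛ c)) n
      ≡⟨ ⊛-suc a (b ⊛ c) n ⟨
    (a ⊛ (b ⊛ c)) (suc n) ∎
    where
    open ≡-Reasoning
    regroup : ∀ u v w x y → u ℤ.* v ℤ.* w ℤ.+ (u ℤ.* x ℤ.+ y) ≡ u ℤ.* (v ℤ.* w ℤ.+ x) ℤ.+ y
    regroup = ℤSolver.solve-∀
    tail-step : (tail (a ⊛ b) ⊛ c) n ≡ a 0 ℤ.* (tail b ⊛ c) n ℤ.+ (tail a ⊛ (b ⊛ c)) n
    tail-step = begin
      (tail (a ⊛ b) ⊛ c) n
        ≡⟨ at (⊛-cong (pointwise {b = (λ j → a 0 ℤ.* tail b j) ⊕ (tail a ⊛ b)} (⊛-suc a b)) (≈-refl {c})) n ⟩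
      (((λ j → a 0 ℤ.* tail b j) ⊕ (tail a ⊛ b)) ⊛ c) n
        ≡⟨ at (⊛-distribʳ-⊕ c (λ j → a 0 ℤ.* tail b j) (tail a ⊛ b)) n ⟩
      ((λ j → a 0 ℤ.* tail b j) ⊛ c) n ℤ.+ ((tail a ⊛ b) ⊛ c) n
        ≡⟨ cong₂ ℤ._+_ (⊛-scale (a 0) (tail b) c n) (go (tail a) n) ⟩
      a 0 ℤ.* (tail b ⊛ c) n ℤ.+ (tail a ⊛ (b ⊛ c)) n ∎

constS-⊛ : ∀ x a n → (constS x ⊛ a) n ≡ x ℤ.* a n
constS-⊛ x a zero    = refl
constS-⊛ x a (suc n) = trans (⊛-suc (constS x) a n)
  (trans (cong (λ z → x ℤ.* a (suc n) ℤ.+ z) (at (⊛-zeroˡ a) n)) (ℤ.+-identityʳ _))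

⊛-identityˡ : ∀ a → oneS ⊛ a ≈ a
⊛-identityˡ a = pointwise λ n → trans (constS-⊛ 1ℤ a n) (ℤ.*-identityˡ (a n))

⊛-identityʳ : ∀ a → a ⊛ oneS ≈ a
⊛-identityʳ a = ≈-trans (⊛-comm a oneS) (⊛-identityˡ a)

seriesRing : AlmostCommutativeRing 0ℓ 0ℓ
seriesRing = record
  { _≈_ = _≈_ ; _+_ = _⊕_ ; _*_ = _⊛_ ; -_ = ⊝_ ; 0# = zeroS ; 1# = oneS
  ; isAlmostCommutativeRing = record
    { isCommutativeSemiring = isCommutativeSemiringˡ record
      { +-isCommutativeMonoid = record
        { isMonoid = record
          { isSemigroup = record
            { isMagma = record { isEquivalence = ≈-isEquivalence ; ∙-cong = ⊕-cong }
            ; assoc = λ a b c → pointwise λ n → ℤ.+-assoc (a n) (b n) (c n) }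
          ; identity = (λ a → pointwise λ n → ℤ.+-identityˡ (a n))
                     , (λ a → pointwise λ n → ℤ.+-identityʳ (a n)) }
        ; comm = λ a b → pointwise λ n → ℤ.+-comm (a n) (b n) }
      ; *-isCommutativeMonoid = record
        { isMonoid = record
          { isSemigroup = record
            { isMagma = record { isEquivalence = ≈-isEquivalence ; ∙-cong = ⊛-cong }
            ; assoc = ⊛-assoc }
          ; identity = ⊛-identityˡ , ⊛-identityʳ }
        ; comm = ⊛-comm }
      ; distribʳ = ⊛-distribʳ-⊕
      ; zeroˡ = ⊛-zeroˡ }
    ; -‿cong = λ p → pointwise λ n → cong ℤ.-_ (at p n)
    ; -‿*-distribˡ = λ a b → pointwise λ n → trans
        (Σ≤-cong n (λ j _ → trans (sym (ℤ.neg-distribˡ-* (a j) _)) (sym (ℤ.-1*i≡-i _))))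
        (trans (Σ≤-* n ℤ.-1ℤ _) (ℤ.-1*i≡-i _))
    ; -‿+-comm = λ a b → pointwise λ n → sym (ℤ.neg-distrib-+ (a n) (b n))
    }
  }
  where
  ≈-isEquivalence : IsEquivalence _≈_
  ≈-isEquivalence = record { refl = ≈-refl ; sym = ≈-sym ; trans = ≈-trans }

-- Integer constants serve as solver coefficients; `con 1ℤ` then denotes `oneS` by conversion.
constS-morphism : ℤ.+-*-rawRing -Raw-AlmostCommutative⟶ seriesRing
constS-morphism = record
  { ⟦_⟧    = constS
  ; +-homo = λ x y → pointwise λ { zero → refl ; (suc n) → refl }
  ; *-homo = λ x y → pointwise λ
      { zero    → refl
      ; (suc n) → sym (trans (constS-⊛ x (constS y) (suc n)) (ℤ.*-zeroʳ x)) }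
  ; -‿homo = λ x → pointwise λ { zero → refl ; (suc n) → refl }
  ; 0-homo = pointwise λ { zero → refl ; (suc n) → refl }
  ; 1-homo = ≈-refl
  }

constS-≟ : ∀ x y → Maybe (constS x ≈ constS y)
constS-≟ x y with x ℤ.≟ y
... | yes refl = just ≈-refl
... | no _     = nothing

open import Algebra.Solver.Ring ℤ.+-*-rawRing seriesRing constS-morphism constS-≟
  using (solve; con; _:+_; _:*_; _:-_; _:^_; _:=_)
open import Algebra.Properties.Semiring.Exp (AlmostCommutativeRing.semiring seriesRing) using (_^_)
import Relation.Binary.Reasoning.Setoid (AlmostCommutativeRing.setoid seriesRing) as ≈-Reasoning
private module S = AlmostCommutativeRing seriesRing

-- Powers of q and the factors 1 - qᵏ.

mono-⊛-< : ∀ {n k} a → n < k → (mono k ⊛ a) n ≡ 0ℤ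
mono-⊛-< {zero}  {suc k} a _         = refl
mono-⊛-< {suc n} {suc k} a (s≤s n<k) = trans (⊛-suc (mono (suc k)) a n)
  (trans (ℤ.+-identityˡ _) (mono-⊛-< a n<k))

mono-⊛-+ : ∀ k a n → (mono k ⊛ a) (k + n) ≡ a n
mono-⊛-+ zero    a n = at (⊛-identityˡ a) n
mono-⊛-+ (suc k) a n = trans (⊛-suc (mono (suc k)) a (k + n))
  (trans (ℤ.+-identityˡ _) (mono-⊛-+ k a n))

shiftQ-suc : ∀ k a n → shiftQ (suc k) a (suc n) ≡ shiftQ k a n
shiftQ-suc zero    a n = refl
shiftQ-suc (suc k) a n = refl

shiftQ≈mono-⊛ : ∀ k a → shiftQ k a ≈ mono k ⊛ a
shiftQ≈mono-⊛ k a = pointwise (go k)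
  where
  go : ∀ k n → shiftQ k a n ≡ (mono k ⊛ a) n
  go zero    n       = sym (at (⊛-identityˡ a) n)
  go (suc k) zero    = refl
  go (suc k) (suc n) = trans (shiftQ-suc k a n) (trans (go k n)
    (sym (trans (⊛-suc (mono (suc k)) a n) (ℤ.+-identityˡ _))))

mono-+ : ∀ j k → mono (j + k) ≈ mono j ⊛ mono k
mono-+ j k = pointwise (go j)
  where
  go : ∀ j n → mono (j + k) n ≡ (mono j ⊛ mono k) n
  go zero    n       = sym (at (⊛-identityˡ (mono k)) n)
  go (suc j) zero    = refl
  go (suc j) (suc n) = trans (go j n)
    (sym (trans (⊛-suc (mono (suc j)) (mono k) n) (ℤ.+-identityˡ _)))

q : Series
q = mono 1

mono≈q^ : ∀ k → mono k ≈ q ^ k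
mono≈q^ zero    = ≈-refl
mono≈q^ (suc k) = ≈-trans (mono-+ 1 k) (⊛-congˡ q (mono≈q^ k))

infix 5 1-_
1-_ : Series → Series
1- a = oneS ⊕ ⊝ a

1-cong : ∀ {a b} → a ≈ b → 1- a ≈ 1- b
1-cong p = pointwise λ n → cong (λ x → oneS n ℤ.- x) (at p n)

-- The two sides agree by conversion, which is why solver identities in `con 1ℤ :- x` apply directly
-- to `oneMinusQ`.
oneMinusQ≈ : ∀ k → oneMinusQ k ≈ 1- mono k
oneMinusQ≈ k = pointwise λ _ → refl

oneMinusQ-⊛ : ∀ k a n → (oneMinusQ k ⊛ a) n ≡ a n ℤ.- (mono k ⊛ a) n
oneMinusQ-⊛ k a n = at (solve 2 (λ x a → (con 1ℤ :- x) :* a := a :- x :* a) ≈-refl (mono k) a) n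

oneMinusQ-inverse : ∀ k → oneMinusQ (suc k) ⊛ invOneMinusQ k ≈ oneS
oneMinusQ-inverse k = pointwise go
  where
  I = invOneMinusQ k
  go : ∀ n → (oneMinusQ (suc k) ⊛ I) n ≡ oneS n
  go n with ℕ.<-≤-connex n (suc k)
  ... | inj₁ n≤k = begin
    (oneMinusQ (suc k) ⊛ I) n      ≡⟨ oneMinusQ-⊛ (suc k) I n ⟩
    I n ℤ.- (mono (suc k) ⊛ I) n   ≡⟨ cong (λ x → I n ℤ.- x) (mono-⊛-< I n≤k) ⟩
    I n ℤ.- 0ℤ                     ≡⟨ ℤ.+-identityʳ (I n) ⟩
    I n                            ≡⟨ cong (λ r → if r ≡ᵇ 0 then 1ℤ else 0ℤ) (ℕ.m<n⇒m%n≡m n≤k) ⟩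
    oneS n                         ∎
    where open ≡-Reasoning
  ... | inj₂ k<n with ℕ.m≤n⇒∃[o]m+o≡n k<n
  ...   | l , refl = begin
    (oneMinusQ (suc k) ⊛ I) (suc k + l)                ≡⟨ oneMinusQ-⊛ (suc k) I (suc k + l) ⟩
    I (suc k + l) ℤ.- (mono (suc k) ⊛ I) (suc k + l)   ≡⟨ cong₂ ℤ._-_ periodic (mono-⊛-+ (suc k) I l) ⟩
    I l ℤ.- I l                                        ≡⟨ ℤ.+-inverseʳ (I l) ⟩
    0ℤ                                                 ∎
    where
    open ≡-Reasoning
    periodic : I (suc k + l) ≡ I l
    periodic = cong (λ r → if r ≡ᵇ 0 then 1ℤ else 0ℤ)
      (trans (cong (_% suc k) (ℕ.+-comm (suc k) l)) (ℕ.[m+n]%n≡m%n l (suc k)))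

-- Gaussian coefficients and the two forms of Pascal's rule.

qPoch-inverse : ∀ m → qPoch m ⊛ qPochInv m ≈ oneS
qPoch-inverse zero    = ⊛-identityˡ oneS
qPoch-inverse (suc m) = begin
  qPoch m ⊛ oneMinusQ (suc m) ⊛ (qPochInv m ⊛ invOneMinusQ m)
    ≈⟨ solve 4 (λ w x y z → w :* x :* (y :* z) := (w :* y) :* (x :* z)) ≈-refl
         (qPoch m) (oneMinusQ (suc m)) (qPochInv m) (invOneMinusQ m) ⟩
  (qPoch m ⊛ qPochInv m) ⊛ (oneMinusQ (suc m) ⊛ invOneMinusQ m)
    ≈⟨ ⊛-cong (qPoch-inverse m) (oneMinusQ-inverse m) ⟩
  oneS ⊛ oneS
    ≈⟨ ⊛-identityˡ oneS ⟩
  oneS ∎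
  where open ≈-Reasoning

-- The quotient of `qPoch (k + N)` by `qPoch N`. Indexing by N instead of N + k avoids truncated
-- subtraction.
numerator : ℕ → ℕ → Series
numerator zero    N = oneS
numerator (suc k) N = numerator k N ⊛ oneMinusQ (suc k + N)

-- gaussian k N is the q-binomial of N + k over k; opaque because conversion checking would
-- otherwise unfold its convolutions.
opaque
  gaussian : ℕ → ℕ → Series
  gaussian k N = numerator k N ⊛ qPochInv k

  gaussian≈ : ∀ k N → gaussian k N ≈ numerator k N ⊛ qPochInv k
  gaussian≈ k N = ≈-refl

qPoch-+ : ∀ k N → qPoch (k + N) ≈ numerator k N ⊛ qPoch N
qPoch-+ zero    N = ≈-sym (⊛-identityˡ (qPoch N))
qPoch-+ (suc k) N = ≈-trans (⊛-congʳ (oneMinusQ (suc k + N)) (qPoch-+ k N))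
  (solve 3 (λ x y z → x :* y :* z := x :* z :* y) ≈-refl
    (numerator k N) (qPoch N) (oneMinusQ (suc k + N)))

qBinom≈gaussian : ∀ k N → qBinom (k + N) k ≈ gaussian k N
qBinom≈gaussian k N rewrite ℕ.m+n∸m≡n k N = begin
  qPoch (k + N) ⊛ qPochInv k ⊛ qPochInv N
    ≈⟨ ⊛-congʳ (qPochInv N) (⊛-congʳ (qPochInv k) (qPoch-+ k N)) ⟩
  numerator k N ⊛ qPoch N ⊛ qPochInv k ⊛ qPochInv N
    ≈⟨ solve 4 (λ w x y z → w :* x :* y :* z := (x :* z) :* (w :* y)) ≈-refl
         (numerator k N) (qPoch N) (qPochInv k) (qPochInv N) ⟩
  (qPoch N ⊛ qPochInv N) ⊛ (numerator k N ⊛ qPochInv k)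
    ≈⟨ ⊛-congˡ (qPoch N ⊛ qPochInv N) (gaussian≈ k N) ⟨
  (qPoch N ⊛ qPochInv N) ⊛ gaussian k N
    ≈⟨ ⊛-congʳ (gaussian k N) (qPoch-inverse N) ⟩
  oneS ⊛ gaussian k N
    ≈⟨ ⊛-identityˡ (gaussian k N) ⟩
  gaussian k N ∎
  where open ≈-Reasoning

-- Peeling the smallest factor instead of the largest lets all three coefficients in Pascal's rule
-- share the block `numerator k (suc N)`.
numerator-suc : ∀ k N → numerator (suc k) N ≈ oneMinusQ (suc N) ⊛ numerator k (suc N)
numerator-suc zero    N = ⊛-comm oneS (oneMinusQ (suc N))
numerator-suc (suc k) N = begin
  numerator (suc k) N ⊛ oneMinusQ (suc (suc k) + N)
    ≈⟨ ⊛-cong (numerator-suc k N) (S.reflexive (cong oneMinusQ (cong suc (sym (ℕ.+-suc k N))))) ⟩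
  oneMinusQ (suc N) ⊛ numerator k (suc N) ⊛ oneMinusQ (suc k + suc N)
    ≈⟨ ⊛-assoc (oneMinusQ (suc N)) (numerator k (suc N)) (oneMinusQ (suc k + suc N)) ⟩
  oneMinusQ (suc N) ⊛ numerator (suc k) (suc N) ∎
  where open ≈-Reasoning

module _ (k N : ℕ) where
  private
    w = mono (suc k)
    z = mono (suc N)
    C = numerator k (suc N)
    J = qPochInv k
    I = invOneMinusQ k

    expand : gaussian (suc k) (suc N) ≈ C ⊛ (1- (w ⊛ z)) ⊛ (J ⊛ I)
    expand = ≈-trans (gaussian≈ (suc k) (suc N)) (⊛-congʳ (J ⊛ I) (⊛-congˡ C
      (≈-trans (oneMinusQ≈ (suc k + suc N)) (1-cong (mono-+ (suc k) (suc N))))))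

    -- The denominator of this coefficient is one factor short of the common one, so (1 - w)/(1 - w)
    -- is inserted.
    insert : gaussian k (suc N) ≈ C ⊛ J ⊛ (oneMinusQ (suc k) ⊛ I)
    insert = ≈-trans (gaussian≈ k (suc N)) (≈-sym (≈-trans (⊛-congˡ (C ⊛ J) (oneMinusQ-inverse k)) (⊛-identityʳ (C ⊛ J))))

    gaussian-suc : gaussian (suc k) N ≈ oneMinusQ (suc N) ⊛ C ⊛ (J ⊛ I)
    gaussian-suc = ≈-trans (gaussian≈ (suc k) N) (⊛-congʳ (J ⊛ I) (numerator-suc k N))

  -- With the common block removed, the two rules are the two splittings 1 - wz = (1 - z) + z(1 - w)
  -- = w(1 - z) + (1 - w).
  pascal₁ : gaussian (suc k) (suc N) ≈ gaussian (suc k) N ⊕ z ⊛ gaussian k (suc N)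
  pascal₁ = begin
    gaussian (suc k) (suc N)
      ≈⟨ expand ⟩
    C ⊛ (1- (w ⊛ z)) ⊛ (J ⊛ I)
      ≈⟨ solve 5 (λ w z C J I → C :* (con 1ℤ :- w :* z) :* (J :* I)
           := (con 1ℤ :- z) :* C :* (J :* I) :+ z :* (C :* J :* ((con 1ℤ :- w) :* I))) ≈-refl w z C J I ⟩
    oneMinusQ (suc N) ⊛ C ⊛ (J ⊛ I) ⊕ z ⊛ (C ⊛ J ⊛ (oneMinusQ (suc k) ⊛ I))
      ≈⟨ ⊕-cong gaussian-suc (⊛-congˡ z insert) ⟨
    gaussian (suc k) N ⊕ z ⊛ gaussian k (suc N) ∎
    where open ≈-Reasoning

  pascal₂ : gaussian (suc k) (suc N) ≈ w ⊛ gaussian (suc k) N ⊕ gaussian k (suc N)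
  pascal₂ = begin
    gaussian (suc k) (suc N)
      ≈⟨ expand ⟩
    C ⊛ (1- (w ⊛ z)) ⊛ (J ⊛ I)
      ≈⟨ solve 5 (λ w z C J I → C :* (con 1ℤ :- w :* z) :* (J :* I)
           := w :* ((con 1ℤ :- z) :* C :* (J :* I)) :+ C :* J :* ((con 1ℤ :- w) :* I)) ≈-refl w z C J I ⟩
    w ⊛ (oneMinusQ (suc N) ⊛ C ⊛ (J ⊛ I)) ⊕ C ⊛ J ⊛ (oneMinusQ (suc k) ⊛ I)
      ≈⟨ ⊕-cong (⊛-congˡ w gaussian-suc) insert ⟨
    w ⊛ gaussian (suc k) N ⊕ gaussian k (suc N) ∎
    where open ≈-Reasoning

-- Palindromic series.

record Palindromic (d : ℕ) (a : Series) : Set where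
  field
    reflect : ∀ {i j} → i + j ≡ d → a i ≡ a j
    vanish  : ∀ {n} → d < n → a n ≡ 0ℤ

open Palindromic

palindromic-≈ : ∀ {a b d} → a ≈ b → Palindromic d a → Palindromic d b
palindromic-≈ a≈b pal = record
  { reflect = λ {i} {j} i+j≡d → trans (sym (at a≈b i)) (trans (reflect pal i+j≡d) (at a≈b j))
  ; vanish  = λ {n} d<n → trans (sym (at a≈b n)) (vanish pal d<n) }

palindromic-one : ∀ {d} → d ≡ 0 → Palindromic d oneS
palindromic-one refl = record
  { reflect = λ { {zero} {zero} _ → refl } ; vanish = λ { (s≤s _) → refl } }

palindromic-mono-⊛ : ∀ {a i j d e} k → Palindromic d a → k + d ≡ e → i + j ≡ e → a i ≡ (mono k ⊛ a) j
palindromic-mono-⊛ {a} {i} {j} {d} k pal refl i+j≡k+d with ℕ.<-≤-connex j k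
... | inj₁ j<k = trans (vanish pal d<i) (sym (mono-⊛-< a j<k))
  where
  d<i : d < i
  d<i = ℕ.+-cancelˡ-< j d i (ℕ.<-≤-trans (ℕ.+-monoˡ-< d j<k)
    (ℕ.≤-reflexive (trans (sym i+j≡k+d) (ℕ.+-comm i j))))
... | inj₂ k≤j with ℕ.m≤n⇒∃[o]m+o≡n k≤j
...   | l , refl = trans (reflect pal i+l≡d) (sym (mono-⊛-+ k a l))
  where
  i+l≡d : i + l ≡ d
  i+l≡d = ℕ.+-cancelˡ-≡ k _ _ (trans (trans (sym (ℕ.+-assoc k i l))
    (trans (cong (_+ l) (ℕ.+-comm k i)) (ℕ.+-assoc i k l))) i+j≡k+d)

vanish-mono-⊛ : ∀ {a n d e} k → Palindromic d a → k + d ≡ e → e < n → (mono k ⊛ a) n ≡ 0ℤ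
vanish-mono-⊛ {a} {n} {d} k pal refl k+d<n
  with ℕ.m≤n⇒∃[o]m+o≡n (ℕ.≤-trans (ℕ.m≤m+n k d) (ℕ.<⇒≤ k+d<n))
... | l , refl = trans (mono-⊛-+ k a l) (vanish pal (ℕ.+-cancelˡ-< k d l k+d<n))

-- Reflection about the larger degree removes the shift from one summand and puts one on the other.
-- It thus carries one expansion of c, and one form of Pascal's rule, into the other.
palindromic-⊕ : ∀ {a b c d d₁ d₂} k₁ k₂ → Palindromic d₁ a → Palindromic d₂ b →
  k₁ + d₁ ≡ d → k₂ + d₂ ≡ d →
  c ≈ a ⊕ mono k₂ ⊛ b → c ≈ mono k₁ ⊛ a ⊕ b → Palindromic d c
palindromic-⊕ {a} {b} {c} {d} {d₁} {d₂} k₁ k₂ pal-a pal-b e₁ e₂ c≈₁ c≈₂ = record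
  { reflect = λ {i} {j} i+j≡d → trans (at c≈₁ i) (trans
      (cong₂ ℤ._+_ (palindromic-mono-⊛ k₁ pal-a e₁ i+j≡d)
        (sym (palindromic-mono-⊛ {i = j} k₂ pal-b e₂ (trans (ℕ.+-comm j i) i+j≡d))))
      (sym (at c≈₂ j)))
  ; vanish  = λ {n} d<n → trans (at c≈₁ n) (cong₂ ℤ._+_
      (vanish pal-a (ℕ.≤-<-trans (ℕ.≤-trans (ℕ.m≤n+m d₁ k₁) (ℕ.≤-reflexive e₁)) d<n))
      (vanish-mono-⊛ k₂ pal-b e₂ d<n))
  }

numerator-zero : ∀ k → numerator k 0 ≈ qPoch k
numerator-zero zero    = ≈-refl
numerator-zero (suc k) = ⊛-cong (numerator-zero k) (S.reflexive (cong oneMinusQ (ℕ.+-identityʳ (suc k))))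

gaussian-palindromic : ∀ k N → Palindromic (k * N) (gaussian k N)
gaussian-palindromic zero    N       = palindromic-≈ (≈-sym (≈-trans (gaussian≈ 0 N) (⊛-identityˡ oneS))) (palindromic-one refl)
gaussian-palindromic (suc k) zero    = palindromic-≈
  (≈-sym (≈-trans (gaussian≈ (suc k) 0)
    (≈-trans (⊛-congʳ (qPochInv (suc k)) (numerator-zero (suc k))) (qPoch-inverse (suc k)))))
  (palindromic-one (ℕ.*-zeroʳ k))
gaussian-palindromic (suc k) (suc N) = palindromic-⊕ (suc k) (suc N)
  (gaussian-palindromic (suc k) N) (gaussian-palindromic k (suc N))
  (sym (ℕ.*-suc (suc k) N)) refl
  (pascal₁ k N) (pascal₂ k N)

mono-⊛-at : ∀ {n} k l a → n ≡ k + l → (mono k ⊛ a) n ≡ a l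
mono-⊛-at k l a refl = mono-⊛-+ k a l

-- Generating functions of the partition counts.

lift : (ℕ → ℕ) → Series
lift g n = ℤ.+ g n

-- The two hypotheses together say that (1 - qᵏ⁺¹) h = g; it remains to cancel the factor.
geometric : ∀ k (g h : ℕ → ℕ) → (∀ {n} → n < suc k → h n ≡ g n) →
  (∀ n → h (suc k + n) ≡ h n + g (suc k + n)) → lift g ⊛ invOneMinusQ k ≈ lift h
geometric k g h base step = begin
  lift g ⊛ invOneMinusQ k
    ≈⟨ ⊛-congʳ (invOneMinusQ k) (pointwise difference) ⟨
  oneMinusQ (suc k) ⊛ lift h ⊛ invOneMinusQ k
    ≈⟨ solve 3 (λ x y z → x :* y :* z := (x :* z) :* y) ≈-refl (oneMinusQ (suc k)) (lift h) (invOneMinusQ k) ⟩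
  oneMinusQ (suc k) ⊛ invOneMinusQ k ⊛ lift h
    ≈⟨ ⊛-congʳ (lift h) (oneMinusQ-inverse k) ⟩
  oneS ⊛ lift h
    ≈⟨ ⊛-identityˡ (lift h) ⟩
  lift h ∎
  where
  open ≈-Reasoning
  difference : ∀ n → (oneMinusQ (suc k) ⊛ lift h) n ≡ lift g n
  difference n with ℕ.<-≤-connex n (suc k)
  ... | inj₁ n≤k = trans (oneMinusQ-⊛ (suc k) (lift h) n) (trans
    (cong₂ ℤ._-_ (cong ℤ.+_ (base n≤k)) (mono-⊛-< (lift h) n≤k)) (ℤ.+-identityʳ (ℤ.+ g n)))
  ... | inj₂ k<n with ℕ.m≤n⇒∃[o]m+o≡n k<n
  ...   | l , refl = trans (oneMinusQ-⊛ (suc k) (lift h) (suc k + l)) (trans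
    (cong₂ ℤ._-_ (cong ℤ.+_ (trans (step l) (ℕ.+-comm (h l) _))) (mono-⊛-+ (suc k) (lift h) l))
    (trans (ℤ.+-assoc (ℤ.+ g (suc k + l)) (ℤ.+ h l) (ℤ.- ℤ.+ h l))
      (trans (cong (λ z → ℤ.+ g (suc k + l) ℤ.+ z) (ℤ.+-inverseʳ (ℤ.+ h l))) (ℤ.+-identityʳ _))))

private
  I₁ I₂ I₃ I₄ I₅ : Series
  I₁ = invOneMinusQ 0
  I₂ = invOneMinusQ 1
  I₃ = invOneMinusQ 2
  I₄ = invOneMinusQ 3
  I₅ = invOneMinusQ 4

parts1 : ℕ → ℕ
parts1 _ = 1

parts∅ : ℕ → ℕ
parts∅ zero    = 1
parts∅ (suc _) = 0

series∅ : oneS ≈ lift parts∅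
series∅ = pointwise λ { zero → refl ; (suc _) → refl }

series1 : I₁ ≈ lift parts1
series1 = ≈-trans (≈-sym (⊛-identityˡ I₁)) (≈-trans (⊛-congʳ I₁ series∅)
  (geometric 0 parts∅ parts1 (λ { {zero} _ → refl ; {suc _} (s≤s ()) }) (λ _ → refl)))

series2 : I₂ ≈ lift parts2
series2 = ≈-trans (≈-sym (⊛-identityˡ I₂)) (≈-trans (⊛-congʳ I₂ series∅)
  (geometric 1 parts∅ parts2
    (λ { {0} _ → refl ; {1} _ → refl ; {suc (suc _)} (s≤s (s≤s ())) })
    (λ n → sym (ℕ.+-identityʳ (parts2 n)))))

series23 : I₂ ⊛ I₃ ≈ lift parts23
series23 = ≈-trans (⊛-congʳ I₃ series2) (geometric 2 parts2 parts23
  (λ { {0} _ → refl ; {1} _ → refl ; {2} _ → refl ; {suc (suc (suc _))} (s≤s (s≤s (s≤s ()))) })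
  (λ _ → refl))

series235 : I₂ ⊛ I₃ ⊛ I₅ ≈ lift parts235
series235 = ≈-trans (⊛-congʳ I₅ series23) (geometric 4 parts23 parts235
  (λ { {0} _ → refl ; {1} _ → refl ; {2} _ → refl ; {3} _ → refl ; {4} _ → refl
     ; {suc (suc (suc (suc (suc _))))} (s≤s (s≤s (s≤s (s≤s (s≤s ()))))) })
  (λ _ → refl))

series2345 : I₂ ⊛ I₃ ⊛ I₅ ⊛ I₄ ≈ lift parts2345
series2345 = ≈-trans (⊛-congʳ I₄ series235) (geometric 3 parts235 parts2345
  (λ { {0} _ → refl ; {1} _ → refl ; {2} _ → refl ; {3} _ → refl
     ; {suc (suc (suc (suc _)))} (s≤s (s≤s (s≤s (s≤s ())))) })
  (λ _ → refl))

series12 : I₁ ⊛ I₂ ≈ lift parts12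
series12 = ≈-trans (⊛-congʳ I₂ series1) (geometric 1 parts1 parts12
  (λ { {0} _ → refl ; {1} _ → refl ; {suc (suc _)} (s≤s (s≤s ())) })
  (λ _ → refl))

series123 : I₁ ⊛ I₂ ⊛ I₃ ≈ lift parts123
series123 = ≈-trans (⊛-congʳ I₃ series12) (geometric 2 parts12 parts123
  (λ { {0} _ → refl ; {1} _ → refl ; {2} _ → refl ; {suc (suc (suc _))} (s≤s (s≤s (s≤s ()))) })
  (λ _ → refl))

series1234 : I₁ ⊛ I₂ ⊛ I₃ ⊛ I₄ ≈ lift parts1234
series1234 = ≈-trans (⊛-congʳ I₄ series123) (geometric 3 parts123 parts1234
  (λ { {0} _ → refl ; {1} _ → refl ; {2} _ → refl ; {3} _ → refl
     ; {suc (suc (suc (suc _)))} (s≤s (s≤s (s≤s (s≤s ())))) })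
  (λ _ → refl))

series1223 : I₁ ⊛ I₂ ⊛ I₃ ⊛ I₂ ≈ lift parts1223
series1223 = ≈-trans (⊛-congʳ I₂ series123) (geometric 1 parts123 parts1223
  (λ { {0} _ → refl ; {1} _ → refl ; {suc (suc _)} (s≤s (s≤s ())) })
  (λ _ → refl))

-- Expansion of the numerator in powers of q to the N + 1.

-- e₁ k and e₂ k are the elementary symmetric functions of 1, q, …, qᵏ⁻¹.
e₁ : ℕ → Series
e₁ zero    = constS 0ℤ
e₁ (suc k) = e₁ k ⊕ q ^ k

e₂ : ℕ → Series
e₂ zero    = constS 0ℤ
e₂ (suc k) = e₂ k ⊕ e₁ k ⊛ q ^ k

-- The numerator is the product of 1 - qⁱ Y over i < k, so the coefficients of its powers of Y are
-- elementary symmetric functions up to sign. The cubic remainder is left unspecified, because Y³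
-- starts in degree 3N + 3, beyond 5N/2.
numerator-expansion : ∀ k N → let Y = mono (suc N) in
  ∃ λ C → numerator k N ≈ oneS ⊕ ⊝ (Y ⊛ e₁ k) ⊕ Y ⊛ Y ⊛ e₂ k ⊕ Y ⊛ Y ⊛ Y ⊛ C
numerator-expansion zero N = constS 0ℤ ,
  solve 1 (λ Y → con 1ℤ := con 1ℤ :- Y :* con 0ℤ :+ Y :* Y :* con 0ℤ :+ Y :* Y :* Y :* con 0ℤ) ≈-refl (mono (suc N))
numerator-expansion (suc k) N with numerator-expansion k N
... | C , numerator≈ = C ⊕ ⊝ (e₂ k ⊛ x) ⊕ ⊝ (Y ⊛ C ⊛ x) , (begin
  numerator k N ⊛ oneMinusQ (suc k + N)
    ≈⟨ ⊛-cong numerator≈ factor ⟩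
  (oneS ⊕ ⊝ (Y ⊛ e₁ k) ⊕ Y ⊛ Y ⊛ e₂ k ⊕ Y ⊛ Y ⊛ Y ⊛ C) ⊛ (1- (x ⊛ Y))
    ≈⟨ solve 5 (λ Y s t C x →
         (con 1ℤ :- Y :* s :+ Y :* Y :* t :+ Y :* Y :* Y :* C) :* (con 1ℤ :- x :* Y)
         := con 1ℤ :- Y :* (s :+ x) :+ Y :* Y :* (t :+ s :* x)
            :+ Y :* Y :* Y :* (C :- t :* x :- Y :* C :* x)) ≈-refl Y (e₁ k) (e₂ k) C x ⟩
  oneS ⊕ ⊝ (Y ⊛ e₁ (suc k)) ⊕ Y ⊛ Y ⊛ e₂ (suc k)
    ⊕ Y ⊛ Y ⊛ Y ⊛ (C ⊕ ⊝ (e₂ k ⊛ x) ⊕ ⊝ (Y ⊛ C ⊛ x)) ∎)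
  where
  open ≈-Reasoning
  Y x : Series
  Y = mono (suc N)
  x = q ^ k
  factor : oneMinusQ (suc k + N) ≈ 1- (x ⊛ Y)
  factor = ≈-trans (S.reflexive (cong oneMinusQ (sym (ℕ.+-suc k N))))
    (≈-trans (oneMinusQ≈ (k + suc N)) (1-cong (≈-trans (mono-+ k (suc N)) (⊛-congʳ Y (mono≈q^ k)))))

-- Multiplication by h exchanges a part of size j + 1 for one of size i + 1.
quotient : ∀ i j h → h ⊛ oneMinusQ (suc i) ≈ oneMinusQ (suc j) → h ⊛ invOneMinusQ j ≈ invOneMinusQ i
quotient i j h eq = begin
  h ⊛ J                             ≈⟨ ⊛-identityʳ (h ⊛ J) ⟨
  h ⊛ J ⊛ oneS                      ≈⟨ ⊛-congˡ (h ⊛ J) (oneMinusQ-inverse i) ⟨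
  h ⊛ J ⊛ (oneMinusQ (suc i) ⊛ I)   ≈⟨ solve 4 (λ w x y z → w :* x :* (y :* z) := (w :* y) :* x :* z) ≈-refl
                                                 h J (oneMinusQ (suc i)) I ⟩
  (h ⊛ oneMinusQ (suc i)) ⊛ J ⊛ I   ≈⟨ ⊛-congʳ I (⊛-congʳ J eq) ⟩
  oneMinusQ (suc j) ⊛ J ⊛ I         ≈⟨ ⊛-congʳ I (oneMinusQ-inverse j) ⟩
  oneS ⊛ I                          ≈⟨ ⊛-identityˡ I ⟩
  I                                 ∎
  where
  open ≈-Reasoning
  I J : Series
  I = invOneMinusQ i
  J = invOneMinusQ j

e₁-telescope : ∀ k → e₁ k ⊛ oneMinusQ 1 ≈ 1- q ^ k
e₁-telescope zero    = solve 1 (λ q → con 0ℤ :* (con 1ℤ :- q) := con 1ℤ :- con 1ℤ) ≈-refl q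
e₁-telescope (suc k) = begin
  (e₁ k ⊕ q ^ k) ⊛ oneMinusQ 1
    ≈⟨ ⊛-distribʳ-⊕ (oneMinusQ 1) (e₁ k) (q ^ k) ⟩
  e₁ k ⊛ oneMinusQ 1 ⊕ q ^ k ⊛ oneMinusQ 1
    ≈⟨ ⊕-cong (e₁-telescope k) (≈-refl {q ^ k ⊛ oneMinusQ 1}) ⟩
  (1- q ^ k) ⊕ q ^ k ⊛ oneMinusQ 1
    ≈⟨ solve 2 (λ q x → con 1ℤ :- x :+ x :* (con 1ℤ :- q) := con 1ℤ :- q :* x) ≈-refl q (q ^ k) ⟩
  1- (q ⊛ q ^ k) ∎
  where open ≈-Reasoning

e₁-⊛ : ∀ k → e₁ (suc k) ⊛ invOneMinusQ k ≈ I₁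
e₁-⊛ k = quotient 0 k (e₁ (suc k)) (≈-trans (e₁-telescope (suc k)) (1-cong (≈-sym (mono≈q^ (suc k)))))

1+q²-⊛ : (oneS ⊕ q ^ 2) ⊛ I₄ ≈ I₂
1+q²-⊛ = quotient 1 3 (oneS ⊕ q ^ 2) (begin
  (oneS ⊕ q ^ 2) ⊛ oneMinusQ 2
    ≈⟨ ⊛-congˡ (oneS ⊕ q ^ 2) (1-cong (mono≈q^ 2)) ⟩
  (oneS ⊕ q ^ 2) ⊛ (1- q ^ 2)
    ≈⟨ solve 1 (λ q → (con 1ℤ :+ q :^ 2) :* (con 1ℤ :- q :^ 2) := con 1ℤ :- q :^ 4) ≈-refl q ⟩
  1- q ^ 4
    ≈⟨ 1-cong (mono≈q^ 4) ⟨
  oneMinusQ 4 ∎)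
  where open ≈-Reasoning

-- This is q times the q-binomial coefficient of 5 over 2, with its quotient (1 - q⁴)/(1 - q²)
-- written as 1 + q². Both factors cancel against the denominator, turning parts 2345 into 1223.
e₂₅ : e₂ 5 ≈ q ⊛ (oneS ⊕ q ^ 2) ⊛ e₁ 5
e₂₅ = solve 1 (λ q →
    con 0ℤ :+ con 0ℤ :* q :^ 0
           :+ (con 0ℤ :+ q :^ 0) :* q :^ 1
           :+ (con 0ℤ :+ q :^ 0 :+ q :^ 1) :* q :^ 2
           :+ (con 0ℤ :+ q :^ 0 :+ q :^ 1 :+ q :^ 2) :* q :^ 3
           :+ (con 0ℤ :+ q :^ 0 :+ q :^ 1 :+ q :^ 2 :+ q :^ 3) :* q :^ 4
    := q :* (con 1ℤ :+ q :^ 2) :* (con 0ℤ :+ q :^ 0 :+ q :^ 1 :+ q :^ 2 :+ q :^ 3 :+ q :^ 4)) ≈-refl q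

Δ : Series → Series
Δ a = oneMinusQ 1 ⊛ a

-- Stated for arbitrary series: with the actual factors in place, conversion checking
-- unfolds every convolution.
assemble₅ : ∀ u G X J Y x s g e C I₁ I₂ I₃ I₄ I₅ →
  G ≈ X ⊛ J → J ≈ oneS ⊛ I₁ ⊛ I₂ ⊛ I₃ ⊛ I₄ ⊛ I₅ →
  X ≈ oneS ⊕ ⊝ (Y ⊛ s) ⊕ Y ⊛ Y ⊛ e ⊕ Y ⊛ Y ⊛ Y ⊛ C → e ≈ x ⊛ g ⊛ s →
  u ⊛ I₁ ≈ oneS → s ⊛ I₅ ≈ I₁ → g ⊛ I₄ ≈ I₂ → ∀ P Q R M₂ M₃ →
  I₂ ⊛ I₃ ⊛ I₅ ⊛ I₄ ≈ P → I₁ ⊛ I₂ ⊛ I₃ ⊛ I₄ ≈ Q → I₁ ⊛ I₂ ⊛ I₃ ⊛ I₂ ≈ R →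
  x ⊛ Y ⊛ Y ≈ M₂ → Y ⊛ Y ⊛ Y ≈ M₃ →
  u ⊛ G ≈
    P ⊕ ⊝ (Y ⊛ Q) ⊕ M₂ ⊛ R ⊕ M₃ ⊛ (C ⊛ (I₂ ⊛ I₃ ⊛ I₅ ⊛ I₄))
assemble₅ u G X J Y x s g e C I₁ I₂ I₃ I₄ I₅ G≈ J≈ X≈ e≈ uI₁ sI₅ gI₄ P Q R M₂ M₃ K≈ Q≈ R≈ M₂≈ M₃≈ = begin
  u ⊛ G
    ≈⟨ ⊛-congˡ u (≈-trans G≈ (⊛-congˡ X J≈)) ⟩
  u ⊛ (X ⊛ (oneS ⊛ I₁ ⊛ I₂ ⊛ I₃ ⊛ I₄ ⊛ I₅))
    ≈⟨ solve 7 (λ u X I₁ I₂ I₃ I₄ I₅ → u :* (X :* (con 1ℤ :* I₁ :* I₂ :* I₃ :* I₄ :* I₅))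
         := (u :* I₁) :* (X :* (I₂ :* I₃ :* I₅ :* I₄))) ≈-refl u X I₁ I₂ I₃ I₄ I₅ ⟩
  (u ⊛ I₁) ⊛ (X ⊛ K)
    ≈⟨ ⊛-cong uI₁ (⊛-congʳ K (≈-trans X≈
         (⊕-cong (⊕-cong (≈-refl {oneS ⊕ ⊝ (Y ⊛ s)}) (⊛-congˡ (Y ⊛ Y) e≈)) (≈-refl {Y ⊛ Y ⊛ Y ⊛ C})))) ⟩
  oneS ⊛ ((oneS ⊕ ⊝ (Y ⊛ s) ⊕ Y ⊛ Y ⊛ (x ⊛ g ⊛ s) ⊕ Y ⊛ Y ⊛ Y ⊛ C) ⊛ K)
    ≈⟨ solve 9 (λ Y x s g C I₂ I₃ I₄ I₅ →
         con 1ℤ :* ((con 1ℤ :- Y :* s :+ Y :* Y :* (x :* g :* s) :+ Y :* Y :* Y :* C) :* (I₂ :* I₃ :* I₅ :* I₄))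
         := I₂ :* I₃ :* I₅ :* I₄ :- Y :* ((s :* I₅) :* I₂ :* I₃ :* I₄)
           :+ x :* Y :* Y :* ((s :* I₅) :* (g :* I₄) :* I₃ :* I₂)
           :+ Y :* Y :* Y :* (C :* (I₂ :* I₃ :* I₅ :* I₄)))
         ≈-refl Y x s g C I₂ I₃ I₄ I₅ ⟩
  K ⊕ ⊝ (Y ⊛ ((s ⊛ I₅) ⊛ I₂ ⊛ I₃ ⊛ I₄)) ⊕ x ⊛ Y ⊛ Y ⊛ ((s ⊛ I₅) ⊛ (g ⊛ I₄) ⊛ I₃ ⊛ I₂) ⊕ Y ⊛ Y ⊛ Y ⊛ (C ⊛ K)
    ≈⟨ ⊕-cong (⊕-cong (⊕-cong K≈ (S.-‿cong (⊛-congˡ Y (≈-trans (⊛-congʳ I₄ (⊛-congʳ I₃ (⊛-congʳ I₂ sI₅))) Q≈))))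
         (⊛-cong M₂≈ (≈-trans (⊛-congʳ I₂ (⊛-congʳ I₃ (⊛-cong sI₅ gI₄))) R≈))) (⊛-congʳ (C ⊛ K) M₃≈) ⟩
  P ⊕ ⊝ (Y ⊛ Q) ⊕ M₂ ⊛ R ⊕ M₃ ⊛ (C ⊛ K) ∎
  where
  open ≈-Reasoning
  K : Series
  K = I₂ ⊛ I₃ ⊛ I₅ ⊛ I₄

assemble₃ : ∀ u G X J Y s e C I₁ I₂ I₃ →
  G ≈ X ⊛ J → J ≈ oneS ⊛ I₁ ⊛ I₂ ⊛ I₃ →
  X ≈ oneS ⊕ ⊝ (Y ⊛ s) ⊕ Y ⊛ Y ⊛ e ⊕ Y ⊛ Y ⊛ Y ⊛ C → u ⊛ I₁ ≈ oneS → s ⊛ I₃ ≈ I₁ → ∀ P Q M₂ →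
  I₂ ⊛ I₃ ≈ P → I₁ ⊛ I₂ ≈ Q → Y ⊛ Y ≈ M₂ →
  u ⊛ G ≈
    P ⊕ ⊝ (Y ⊛ Q) ⊕ M₂ ⊛ ((e ⊕ Y ⊛ C) ⊛ (I₂ ⊛ I₃))
assemble₃ u G X J Y s e C I₁ I₂ I₃ G≈ J≈ X≈ uI₁ sI₃ P Q M₂ P≈ Q≈ M₂≈ = begin
  u ⊛ G
    ≈⟨ ⊛-congˡ u (≈-trans G≈ (⊛-congˡ X J≈)) ⟩
  u ⊛ (X ⊛ (oneS ⊛ I₁ ⊛ I₂ ⊛ I₃))
    ≈⟨ solve 5 (λ u X I₁ I₂ I₃ → u :* (X :* (con 1ℤ :* I₁ :* I₂ :* I₃))
         := (u :* I₁) :* (X :* (I₂ :* I₃))) ≈-refl u X I₁ I₂ I₃ ⟩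
  (u ⊛ I₁) ⊛ (X ⊛ (I₂ ⊛ I₃))
    ≈⟨ ⊛-cong uI₁ (⊛-congʳ (I₂ ⊛ I₃) X≈) ⟩
  oneS ⊛ ((oneS ⊕ ⊝ (Y ⊛ s) ⊕ Y ⊛ Y ⊛ e ⊕ Y ⊛ Y ⊛ Y ⊛ C) ⊛ (I₂ ⊛ I₃))
    ≈⟨ solve 6 (λ Y s e C I₂ I₃ →
         con 1ℤ :* ((con 1ℤ :- Y :* s :+ Y :* Y :* e :+ Y :* Y :* Y :* C) :* (I₂ :* I₃))
         := I₂ :* I₃ :- Y :* ((s :* I₃) :* I₂) :+ Y :* Y :* ((e :+ Y :* C) :* (I₂ :* I₃)))
         ≈-refl Y s e C I₂ I₃ ⟩
  I₂ ⊛ I₃ ⊕ ⊝ (Y ⊛ ((s ⊛ I₃) ⊛ I₂)) ⊕ Y ⊛ Y ⊛ ((e ⊕ Y ⊛ C) ⊛ (I₂ ⊛ I₃))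
    ≈⟨ ⊕-cong (⊕-cong P≈ (S.-‿cong (⊛-congˡ Y (≈-trans (⊛-congʳ I₂ sI₃) Q≈))))
         (⊛-congʳ ((e ⊕ Y ⊛ C) ⊛ (I₂ ⊛ I₃)) M₂≈) ⟩
  P ⊕ ⊝ (Y ⊛ Q) ⊕ M₂ ⊛ ((e ⊕ Y ⊛ C) ⊛ (I₂ ⊛ I₃)) ∎
  where open ≈-Reasoning

opaque
  Δ-gaussian₅ : ∀ N → ∃ λ C → Δ (gaussian 5 N) ≈
    lift parts2345 ⊕ ⊝ (mono (1 + N) ⊛ lift parts1234)
      ⊕ mono (3 + (N + N)) ⊛ lift parts1223 ⊕ mono (3 + (N + N + N)) ⊛ C
  Δ-gaussian₅ N = from (numerator-expansion 5 N)
    where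
    Y M₂ M₃ : Series
    Y = mono (1 + N)
    M₂ = mono (3 + (N + N))
    M₃ = mono (3 + (N + N + N))
    shift₂ : q ⊛ Y ⊛ Y ≈ M₂
    shift₂ = ≈-trans (⊛-congʳ Y (≈-sym (mono-+ 1 (1 + N)))) (≈-trans (≈-sym (mono-+ (2 + N) (1 + N)))
      (S.reflexive (cong (λ i → mono (2 + i)) (ℕ.+-suc N N))))
    index : ∀ N → 1 + N + (1 + N) + (1 + N) ≡ 3 + (N + N + N)
    index = solve-∀
    shift₃ : Y ⊛ Y ⊛ Y ≈ M₃
    shift₃ = ≈-trans (⊛-congʳ Y (≈-sym (mono-+ (1 + N) (1 + N))))
      (≈-trans (≈-sym (mono-+ (1 + N + (1 + N)) (1 + N))) (S.reflexive (cong mono (index N))))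
    from : (∃ λ C → numerator 5 N ≈ oneS ⊕ ⊝ (Y ⊛ e₁ 5) ⊕ Y ⊛ Y ⊛ e₂ 5 ⊕ Y ⊛ Y ⊛ Y ⊛ C) →
      ∃ λ C → Δ (gaussian 5 N) ≈ lift parts2345 ⊕ ⊝ (Y ⊛ lift parts1234) ⊕ M₂ ⊛ lift parts1223 ⊕ M₃ ⊛ C
    from (C , numerator≈) = C ⊛ (I₂ ⊛ I₃ ⊛ I₅ ⊛ I₄) ,
      assemble₅ (oneMinusQ 1) (gaussian 5 N) (numerator 5 N) (qPochInv 5)
        Y q (e₁ 5) (oneS ⊕ q ^ 2) (e₂ 5) C I₁ I₂ I₃ I₄ I₅
        (gaussian≈ 5 N) (≈-refl {qPochInv 5}) numerator≈ e₂₅ (oneMinusQ-inverse 0) (e₁-⊛ 4) 1+q²-⊛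
        (lift parts2345) (lift parts1234) (lift parts1223) M₂ M₃
        series2345 series1234 series1223 shift₂ shift₃

  Δ-gaussian₃ : ∀ B → ∃ λ C → Δ (gaussian 3 B) ≈
    lift parts23 ⊕ ⊝ (mono (1 + B) ⊛ lift parts12) ⊕ mono (2 + (B + B)) ⊛ C
  Δ-gaussian₃ B = from (numerator-expansion 3 B)
    where
    Y M₂ : Series
    Y = mono (1 + B)
    M₂ = mono (2 + (B + B))
    from : (∃ λ C → numerator 3 B ≈ oneS ⊕ ⊝ (Y ⊛ e₁ 3) ⊕ Y ⊛ Y ⊛ e₂ 3 ⊕ Y ⊛ Y ⊛ Y ⊛ C) →
      ∃ λ C → Δ (gaussian 3 B) ≈ lift parts23 ⊕ ⊝ (Y ⊛ lift parts12) ⊕ M₂ ⊛ C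
    from (C , numerator≈) = (e₂ 3 ⊕ Y ⊛ C) ⊛ (I₂ ⊛ I₃) ,
      assemble₃ (oneMinusQ 1) (gaussian 3 B) (numerator 3 B) (qPochInv 3) Y (e₁ 3) (e₂ 3) C I₁ I₂ I₃
        (gaussian≈ 3 B) (≈-refl {qPochInv 3}) numerator≈ (oneMinusQ-inverse 0) (e₁-⊛ 2)
        (lift parts23) (lift parts12) M₂ series23 series12
        (≈-trans (≈-sym (mono-+ (1 + B) (1 + B))) (S.reflexive (cong (λ i → mono (1 + i)) (ℕ.+-suc B B))))

-- Coefficients of (1 - q) times the Gaussian coefficients in the left half.

module _ (N : ℕ) where
  private
    C₅ = proj₁ (Δ-gaussian₅ N)
    Y₁ = mono (1 + N)
    Y₂ = mono (3 + (N + N))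
    Y₃ = mono (3 + (N + N + N))

    Δ₅ : ∀ n {x y z} → (Y₁ ⊛ lift parts1234) n ≡ x → (Y₂ ⊛ lift parts1223) n ≡ y → (Y₃ ⊛ C₅) n ≡ z →
      Δ (gaussian 5 N) n ≡ ℤ.+ parts2345 n ℤ.- x ℤ.+ y ℤ.+ z
    Δ₅ n refl refl refl = at (proj₂ (Δ-gaussian₅ N)) n

  Δ-gaussian₅-low : ∀ {n} → n ≤ N → Δ (gaussian 5 N) n ≡ ℤ.+ parts2345 n
  Δ-gaussian₅-low {n} n≤N = trans
    (Δ₅ n (mono-⊛-< (lift parts1234) (s≤s n≤N))
          (mono-⊛-< (lift parts1223) (s≤s (ℕ.m≤n⇒m≤o+n 2 (ℕ.m≤n⇒m≤n+o N n≤N))))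
          (mono-⊛-< C₅ (s≤s (ℕ.m≤n⇒m≤o+n 2 (ℕ.m≤n⇒m≤n+o N (ℕ.m≤n⇒m≤n+o N n≤N))))))
    (simplify (ℤ.+ parts2345 n))
    where
    simplify : ∀ p → p ℤ.- 0ℤ ℤ.+ 0ℤ ℤ.+ 0ℤ ≡ p
    simplify p = trans (ℤ.+-identityʳ _) (trans (ℤ.+-identityʳ _) (ℤ.+-identityʳ p))

  Δ-gaussian₅-middle : ∀ x → x ≤ 1 + N →
    Δ (gaussian 5 N) (1 + N + x) ≡ ℤ.+ parts2345 (1 + N + x) ℤ.- ℤ.+ parts1234 x
  Δ-gaussian₅-middle x x≤1+N = trans
    (Δ₅ (1 + N + x) (mono-⊛-+ (1 + N) (lift parts1234) x) (mono-⊛-< (lift parts1223) bound)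
      (mono-⊛-< C₅ (ℕ.<-≤-trans bound (ℕ.+-monoʳ-≤ 3 (ℕ.m≤m+n (N + N) N)))))
    (trans (ℤ.+-identityʳ _) (ℤ.+-identityʳ _))
    where
    bound : 1 + N + x < 3 + (N + N)
    bound = s≤s (ℕ.≤-trans (ℕ.+-monoʳ-≤ (1 + N) x≤1+N) (ℕ.≤-reflexive (cong suc (ℕ.+-suc N N))))

  Δ-gaussian₅-high : ∀ y → y < N → let n = 3 + 2 * N + y in
    Δ (gaussian 5 N) n ≡ ℤ.+ parts2345 n ℤ.- ℤ.+ parts1234 (2 + N + y) ℤ.+ ℤ.+ parts1223 y
  Δ-gaussian₅-high y y<N = trans
    (Δ₅ (3 + 2 * N + y)
      (mono-⊛-at (1 + N) (2 + N + y) (lift parts1234) (index₁ N y))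
      (mono-⊛-at (3 + (N + N)) y (lift parts1223) (index₂ N y))
      (mono-⊛-< C₅ (ℕ.≤-<-trans (ℕ.≤-reflexive (index₂ N y)) (ℕ.+-monoʳ-< (3 + (N + N)) y<N))))
    (ℤ.+-identityʳ _)
    where
    index₁ : ∀ N y → 3 + 2 * N + y ≡ 1 + N + (2 + N + y)
    index₁ = solve-∀
    index₂ : ∀ N y → 3 + 2 * N + y ≡ 3 + (N + N) + y
    index₂ = solve-∀

m+n≤o⇒m≤o-n : ∀ m n o → m + n ≤ o → ℤ.+ m ℤ.≤ ℤ.+ o ℤ.- ℤ.+ n
m+n≤o⇒m≤o-n m n o m+n≤o = ℤ.≤-trans
  (ℤ.≤-reflexive (sym (trans (ℤ.+-assoc (ℤ.+ m) (ℤ.+ n) (ℤ.- ℤ.+ n))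
    (trans (cong (λ z → ℤ.+ m ℤ.+ z) (ℤ.+-inverseʳ (ℤ.+ n))) (ℤ.+-identityʳ (ℤ.+ m))))))
  (ℤ.+-monoˡ-≤ (ℤ.- ℤ.+ n) (ℤ.+≤+ m+n≤o))

Δ-gaussian₅-lower : ∀ N n → 1000 ≤ N → 2 * n ≤ 5 * N → ℤ.+ parts23 n ℤ.≤ Δ (gaussian 5 N) n
Δ-gaussian₅-lower N n 1000≤N 2n≤5N with ℕ.≤-<-connex n N
... | inj₁ n≤N = ℤ.≤-trans (ℤ.+≤+ (parts23≤parts2345 n)) (ℤ.≤-reflexive (sym (Δ-gaussian₅-low N n≤N)))
... | inj₂ N<n with ℕ.m≤n⇒∃[o]m+o≡n N<n
...   | x , refl with ℕ.≤-<-connex x (1 + N)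
...     | inj₁ x≤1+N = ℤ.≤-trans
  (m+n≤o⇒m≤o-n (parts23 n) (parts1234 x) (parts2345 n) (middle-range N x 1000≤N x≤1+N))
  (ℤ.≤-reflexive (sym (Δ-gaussian₅-middle N x x≤1+N)))
...     | inj₂ 2+N≤x with ℕ.m≤n⇒∃[o]m+o≡n 2+N≤x
...       | y , refl = high (ℕ.m≤n⇒∃[o]m+o≡n 6+2y≤N)
  where
  rearrange₁ : ∀ N y → 2 * (1 + N + (2 + N + y)) ≡ 4 * N + (6 + 2 * y)
  rearrange₁ = solve-∀
  rearrange₂ : ∀ N → 5 * N ≡ 4 * N + N
  rearrange₂ = solve-∀
  -- In terms of y the bound 2n ≤ 5N takes this form; its slack is the w of `upper-range`.
  6+2y≤N : 6 + 2 * y ≤ N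
  6+2y≤N = ℕ.+-cancelˡ-≤ (4 * N) _ _ (subst₂ _≤_ (rearrange₁ N y) (rearrange₂ N) 2n≤5N)
  index : ∀ N y → 3 + 2 * N + y ≡ 1 + N + (2 + N + y)
  index = solve-∀
  high : (∃ λ w → 6 + 2 * y + w ≡ N) → ℤ.+ parts23 n ℤ.≤ Δ (gaussian 5 N) n
  high (w , refl) = subst (λ n → ℤ.+ parts23 n ℤ.≤ Δ (gaussian 5 N) n) (index N y) (begin
    ℤ.+ parts23 n′
      ≤⟨ m+n≤o⇒m≤o-n (parts23 n′) (parts1234 (2 + N + y)) (parts2345 n′ + parts1223 y) (upper-range y w 1000≤N) ⟩
    ℤ.+ parts2345 n′ ℤ.+ ℤ.+ parts1223 y ℤ.- ℤ.+ parts1234 (2 + N + y)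
      ≡⟨ swap (ℤ.+ parts2345 n′) (ℤ.+ parts1223 y) (ℤ.- ℤ.+ parts1234 (2 + N + y)) ⟩
    ℤ.+ parts2345 n′ ℤ.- ℤ.+ parts1234 (2 + N + y) ℤ.+ ℤ.+ parts1223 y
      ≡⟨ Δ-gaussian₅-high N y y<N ⟨
    Δ (gaussian 5 N) n′ ∎)
    where
    open ℤ.≤-Reasoning
    n′ : ℕ
    n′ = 3 + 2 * N + y
    swap : ∀ x y z → x ℤ.+ y ℤ.+ z ≡ x ℤ.+ z ℤ.+ y
    swap x y z = trans (ℤ.+-assoc x y z) (trans (cong (λ u → x ℤ.+ u) (ℤ.+-comm y z)) (sym (ℤ.+-assoc x z y)))
    y<N : y < N
    y<N = ℕ.≤-trans (s≤s (ℕ.m≤n⇒m≤o+n 5 (ℕ.m≤m+n y (y + 0)))) 6+2y≤N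

module _ (B : ℕ) where
  private
    C₃ = proj₁ (Δ-gaussian₃ B)
    Z = mono (1 + B) ⊛ lift parts12

    Δ₃ : ∀ n → n < 2 + (B + B) → Δ (gaussian 3 B) n ≡ ℤ.+ parts23 n ℤ.- Z n
    Δ₃ n bound = trans (at (proj₂ (Δ-gaussian₃ B)) n)
      (trans (cong (λ z → ℤ.+ parts23 n ℤ.- Z n ℤ.+ z) (mono-⊛-< C₃ bound)) (ℤ.+-identityʳ _))

  Δ-gaussian₃-low : ∀ {n} → n ≤ B → Δ (gaussian 3 B) n ≡ ℤ.+ parts23 n
  Δ-gaussian₃-low {n} n≤B = trans (Δ₃ n (s≤s (ℕ.m≤n⇒m≤1+n (ℕ.m≤n⇒m≤n+o B n≤B))))
    (trans (cong (λ z → ℤ.+ parts23 n ℤ.- z) (mono-⊛-< (lift parts12) (s≤s n≤B))) (ℤ.+-identityʳ _))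

  -- Up to degree 3B/2 the only correction is the negative term with parts 1 and 2, which may be
  -- dropped; the remainder starts in degree 2B + 2.
  Δ-gaussian₃-upper : ∀ n → 2 * n ≤ 3 * B → Δ (gaussian 3 B) n ℤ.≤ ℤ.+ parts23 n
  Δ-gaussian₃-upper n 2n≤3B with ℕ.≤-<-connex n B
  ... | inj₁ n≤B = ℤ.≤-reflexive (Δ-gaussian₃-low n≤B)
  ... | inj₂ B<n with ℕ.m≤n⇒∃[o]m+o≡n B<n
  ...   | x , refl = ℤ.≤-trans (ℤ.≤-reflexive (trans (Δ₃ n bound)
      (cong (λ z → ℤ.+ parts23 n ℤ.- z) (mono-⊛-+ (1 + B) (lift parts12) x))))
    (ℤ.i≤j⇒i-k≤j (ℤ.+ parts12 x) ℤ.≤-refl)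
    where
    n≤2B : n ≤ B + B
    n≤2B = ℕ.*-cancelˡ-≤ 2 (ℕ.≤-trans 2n≤3B (ℕ.≤-trans (ℕ.m≤m+n (3 * B) B) (ℕ.≤-reflexive (rearrange B))))
      where
      rearrange : ∀ B → 3 * B + B ≡ 2 * (B + B)
      rearrange = solve-∀
    bound : n < 2 + (B + B)
    bound = s≤s (ℕ.m≤n⇒m≤1+n n≤2B)

-- From nonnegative differences in the left half to unimodality.

Δ-zero : ∀ a → Δ a 0 ≡ a 0
Δ-zero a = trans (oneMinusQ-⊛ 1 a 0) (ℤ.+-identityʳ (a 0))

Δ-suc : ∀ a n → Δ a (suc n) ≡ a (suc n) ℤ.- a n
Δ-suc a n = trans (oneMinusQ-⊛ 1 a (suc n)) (cong (λ z → a (suc n) ℤ.- z) (mono-⊛-+ 1 a n))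

step-up : ∀ a n → 0ℤ ℤ.≤ Δ a (suc n) → a n ℤ.≤ a (suc n)
step-up a n 0≤Δ = ℤ.0≤i-j⇒j≤i (ℤ.≤-trans 0≤Δ (ℤ.≤-reflexive (Δ-suc a n)))

module _ {d : ℕ} {a : Series} (pal : Palindromic d a) (Δ≥0 : ∀ n → 2 * n ≤ d → 0ℤ ℤ.≤ Δ a n) where
  private
    increasing : ∀ i k → 2 * (k + i) ≤ d → a i ℤ.≤ a (k + i)
    increasing i zero    _      = ℤ.≤-refl
    increasing i (suc k) 2j≤d   = ℤ.≤-trans
      (increasing i k (ℕ.≤-trans (ℕ.*-monoʳ-≤ 2 (ℕ.n≤1+n (k + i))) 2j≤d))
      (step-up a (k + i) (Δ≥0 (suc (k + i)) 2j≤d))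

    left-nonneg : ∀ n → 2 * n ≤ d → 0ℤ ℤ.≤ a n
    left-nonneg n 2n≤d = ℤ.≤-trans (ℤ.≤-trans (Δ≥0 0 z≤n) (ℤ.≤-reflexive (Δ-zero a)))
      (subst (λ j → a 0 ℤ.≤ a j) (ℕ.+-identityʳ n) (increasing 0 n (subst (λ j → 2 * j ≤ d) (sym (ℕ.+-identityʳ n)) 2n≤d)))

    mirror : ∀ i j → i + j ≡ d → d ≤ 2 * i → 2 * j ≤ d
    mirror i j refl i+j≤2i = ℕ.≤-trans (ℕ.≤-reflexive (cong (j +_) (ℕ.+-identityʳ j)))
      (ℕ.+-monoˡ-≤ j (subst (j ≤_) (ℕ.+-identityʳ i) (ℕ.+-cancelˡ-≤ i _ _ i+j≤2i)))

  palindromic-nonnegative : Nonnegative a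
  palindromic-nonnegative n with ℕ.≤-<-connex (2 * n) d
  ... | inj₁ 2n≤d = left-nonneg n 2n≤d
  ... | inj₂ d<2n with ℕ.≤-<-connex n d
  ...   | inj₂ d<n = ℤ.≤-reflexive (sym (vanish pal d<n))
  ...   | inj₁ n≤d with ℕ.m≤n⇒∃[o]m+o≡n n≤d
  ...     | j , n+j≡d = ℤ.≤-trans (left-nonneg j (mirror n j n+j≡d (ℕ.<⇒≤ d<2n))) (ℤ.≤-reflexive (sym (reflect pal n+j≡d)))

  private
    -- The condition says that i is at least `⌊ d /2⌋`, without mentioning the halving.
    step-down : ∀ i → d ≤ suc (2 * i) → a (suc i) ℤ.≤ a i
    step-down i d≤1+2i with ℕ.≤-<-connex (suc i) d
    ... | inj₂ d<1+i = ℤ.≤-trans (ℤ.≤-reflexive (vanish pal d<1+i)) (palindromic-nonnegative i)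
    ... | inj₁ 1+i≤d with ℕ.m≤n⇒∃[o]m+o≡n 1+i≤d
    ...   | j , 1+i+j≡d with ℕ.m≤n⇒m<n∨m≡n d≤1+2i
    -- For odd d these are the two central indices: they mirror each other, so no difference is
    -- involved.
    ...     | inj₂ d≡1+2i = ℤ.≤-reflexive (reflect pal (trans (odd i) (sym d≡1+2i)))
      where
      odd : ∀ i → suc i + i ≡ suc (2 * i)
      odd = solve-∀
    ...     | inj₁ (s≤s d≤2i) = begin
      a (suc i)   ≡⟨ reflect pal 1+i+j≡d ⟩
      a j         ≤⟨ step-up a j (Δ≥0 (suc j) (mirror i (suc j) i+1+j≡d d≤2i)) ⟩
      a (suc j)   ≡⟨ reflect pal i+1+j≡d ⟨
      a i         ∎
      where
      open ℤ.≤-Reasoning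
      i+1+j≡d : i + suc j ≡ d
      i+1+j≡d = trans (ℕ.+-suc i j) 1+i+j≡d

    decreasing : ∀ i k → d ≤ suc (2 * i) → a (k + i) ℤ.≤ a i
    decreasing i zero    _      = ℤ.≤-refl
    decreasing i (suc k) d≤1+2i = ℤ.≤-trans
      (step-down (k + i) (ℕ.≤-trans d≤1+2i (s≤s (ℕ.*-monoʳ-≤ 2 (ℕ.m≤n+m i k)))))
      (decreasing i k d≤1+2i)

    half : ∀ d → 2 * ⌊ d /2⌋ ≤ d × d ≤ suc (2 * ⌊ d /2⌋)
    half zero          = z≤n , z≤n
    half (suc zero)    = z≤n , ℕ.≤-refl
    half (suc (suc d)) = subst (_≤ suc (suc d)) (double ⌊ d /2⌋) (s≤s (s≤s (proj₁ (half d))))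
                       , subst (λ h → suc (suc d) ≤ suc h) (double ⌊ d /2⌋) (s≤s (s≤s (proj₂ (half d))))
      where
      double : ∀ h → suc (suc (2 * h)) ≡ 2 * suc h
      double = solve-∀

  palindromic-unimodal : Unimodal a
  palindromic-unimodal = ⌊ d /2⌋ , up , down
    where
    up : ∀ i j → i ≤ j → j ≤ ⌊ d /2⌋ → a i ℤ.≤ a j
    up i j i≤j j≤d/2 = subst (λ j → a i ℤ.≤ a j) (ℕ.m∸n+n≡m i≤j) (increasing i (j ∸ i)
      (subst (λ j → 2 * j ≤ d) (sym (ℕ.m∸n+n≡m i≤j)) (ℕ.≤-trans (ℕ.*-monoʳ-≤ 2 j≤d/2) (proj₁ (half d)))))
    down : ∀ i j → ⌊ d /2⌋ ≤ i → i ≤ j → a j ℤ.≤ a i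
    down i j d/2≤i i≤j = subst (λ j → a j ℤ.≤ a i) (ℕ.m∸n+n≡m i≤j) (decreasing i (j ∸ i)
      (ℕ.≤-trans (proj₂ (half d)) (s≤s (ℕ.*-monoʳ-≤ 2 d/2≤i))))

-- The difference of the two Gaussian coefficients.

gap : ℕ → ℕ → ℕ → Series
gap N B s = gaussian 5 N ⊖ shiftQ s (gaussian 3 B)

Δ-gap : ∀ N B s n → Δ (gap N B s) n ≡ Δ (gaussian 5 N) n ℤ.- (mono s ⊛ Δ (gaussian 3 B)) n
Δ-gap N B s n = at (begin
  oneMinusQ 1 ⊛ (gaussian 5 N ⊖ shiftQ s (gaussian 3 B))
    ≈⟨ ⊛-congˡ (oneMinusQ 1) (pointwise λ i → cong (λ z → gaussian 5 N i ℤ.- z) (at (shiftQ≈mono-⊛ s (gaussian 3 B)) i)) ⟩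
  oneMinusQ 1 ⊛ (gaussian 5 N ⊖ (mono s ⊛ gaussian 3 B))
    ≈⟨ solve 4 (λ u g x h → u :* (g :- x :* h) := u :* g :- x :* (u :* h)) ≈-refl
         (oneMinusQ 1) (gaussian 5 N) (mono s) (gaussian 3 B) ⟩
  Δ (gaussian 5 N) ⊖ (mono s ⊛ Δ (gaussian 3 B)) ∎) n
  where open ≈-Reasoning

gap-palindromic : ∀ N B s → 2 * s + 3 * B ≡ 5 * N → Palindromic (5 * N) (gap N B s)
gap-palindromic N B s 2s+3B≡5N = record
  { reflect = λ {i} {j} i+j≡5N → cong₂ ℤ._-_ (reflect pal₅ i+j≡5N)
      (trans (at (shiftQ≈mono-⊛ s (gaussian 3 B)) i)
        (trans (shifted i j i+j≡5N) (sym (at (shiftQ≈mono-⊛ s (gaussian 3 B)) j))))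
  ; vanish  = λ {n} 5N<n → cong₂ ℤ._-_ (vanish pal₅ 5N<n)
      (trans (at (shiftQ≈mono-⊛ s (gaussian 3 B)) n) (vanish-mono-⊛ s pal₃ refl (ℕ.≤-<-trans s+3B≤5N 5N<n)))
  }
  where
  pal₅ : Palindromic (5 * N) (gaussian 5 N)
  pal₅ = gaussian-palindromic 5 N
  pal₃ : Palindromic (3 * B) (gaussian 3 B)
  pal₃ = gaussian-palindromic 3 B
  s+3B≤5N : s + 3 * B ≤ 5 * N
  s+3B≤5N = ℕ.≤-trans (ℕ.+-monoˡ-≤ (3 * B) (ℕ.m≤m+n s (s + 0))) (ℕ.≤-reflexive 2s+3B≡5N)
  shifted : ∀ i j → i + j ≡ 5 * N → (mono s ⊛ gaussian 3 B) i ≡ (mono s ⊛ gaussian 3 B) j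
  shifted i j i+j≡5N with ℕ.<-≤-connex i s
  ... | inj₁ i<s = trans (mono-⊛-< (gaussian 3 B) i<s) (sym (vanish-mono-⊛ s pal₃ refl s+3B<j))
    where
    regroup : ∀ s b → 2 * s + b ≡ s + (s + b)
    regroup = solve-∀
    s+3B<j : s + 3 * B < j
    s+3B<j = ℕ.+-cancelˡ-< i _ _ (ℕ.<-≤-trans (ℕ.+-monoˡ-< (s + 3 * B) i<s)
      (ℕ.≤-reflexive (trans (sym (regroup s (3 * B))) (trans 2s+3B≡5N (sym i+j≡5N)))))
  ... | inj₂ s≤i with ℕ.m≤n⇒∃[o]m+o≡n s≤i
  -- Since 5N = s + (s + 3B), removing the shift from i leaves l + j = s + 3B, the reflection that
  -- exchanges a series with its shift by s.
  ...   | l , refl = trans (mono-⊛-+ s (gaussian 3 B) l)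
    (palindromic-mono-⊛ s pal₃ refl (ℕ.+-cancelˡ-≡ s _ _ (trans (sym (ℕ.+-assoc s l j)) (trans i+j≡5N
      (trans (sym 2s+3B≡5N) (regroup s (3 * B)))))))
    where
    regroup : ∀ s b → 2 * s + b ≡ s + (s + b)
    regroup = solve-∀

Δ-gap-nonneg : ∀ N B s → 1000 ≤ N → 2 * s + 3 * B ≡ 5 * N → s ≢ 1 →
  ∀ n → 2 * n ≤ 5 * N → 0ℤ ℤ.≤ Δ (gap N B s) n
Δ-gap-nonneg N B s 1000≤N 2s+3B≡5N s≢1 n 2n≤5N = ℤ.≤-trans
  (ℤ.i≤j⇒0≤j-i (ℤ.≤-trans shifted (Δ-gaussian₅-lower N n 1000≤N 2n≤5N)))
  (ℤ.≤-reflexive (sym (Δ-gap N B s n)))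
  where
  shifted : (mono s ⊛ Δ (gaussian 3 B)) n ℤ.≤ ℤ.+ parts23 n
  shifted with ℕ.<-≤-connex n s
  ... | inj₁ n<s = ℤ.≤-trans (ℤ.≤-reflexive (mono-⊛-< (Δ (gaussian 3 B)) n<s)) (ℤ.+≤+ z≤n)
  ... | inj₂ s≤n with ℕ.m≤n⇒∃[o]m+o≡n s≤n
  ...   | j , refl = begin
    (mono s ⊛ Δ (gaussian 3 B)) (s + j)   ≡⟨ mono-⊛-+ s (Δ (gaussian 3 B)) j ⟩
    Δ (gaussian 3 B) j                    ≤⟨ Δ-gaussian₃-upper B j 2j≤3B ⟩
    ℤ.+ parts23 j                         ≤⟨ ℤ.+≤+ (parts23-mono s j s≢1) ⟩
    ℤ.+ parts23 (s + j)                   ∎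
    where
    open ℤ.≤-Reasoning
    -- The common centre makes the left halves correspond: 2 (s + j) ≤ 5N = 2s + 3B.
    2j≤3B : 2 * j ≤ 3 * B
    2j≤3B = ℕ.+-cancelˡ-≤ (2 * s) _ _ (subst₂ _≤_ (ℕ.*-distribˡ-+ 2 s j) (sym 2s+3B≡5N) 2n≤5N)

-- The drop from degree 0 to 1 forces the peak to be at 0, and the rise from 1 to 2 forbids it
-- there. The bounds on N and B keep these degrees below the first correction terms.
gap-nonunimodal : ∀ N B → 2 ≤ N → 1 ≤ B → ¬ Unimodal (gap N B 1)
gap-nonunimodal N B 2≤N 1≤B (zero  , up , down) = absurd
  (subst (ℤ._≤ 0ℤ) (trans (sym (Δ-suc F 1)) Δ₂) (ℤ.i≤j⇒i-j≤0 (down 1 2 z≤n (s≤s z≤n))))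
  where
  F : Series
  F = gap N B 1
  Δ₂ : Δ F 2 ≡ 1ℤ
  Δ₂ = trans (Δ-gap N B 1 2) (cong₂ ℤ._-_ (Δ-gaussian₅-low N 2≤N)
    (trans (mono-⊛-+ 1 (Δ (gaussian 3 B)) 1) (Δ-gaussian₃-low B 1≤B)))
  absurd : ¬ 1ℤ ℤ.≤ 0ℤ
  absurd (ℤ.+≤+ ())
gap-nonunimodal N B 2≤N 1≤B (suc t , up , down) = absurd
  (subst (0ℤ ℤ.≤_) (trans (sym (Δ-suc F 0)) Δ₁) (ℤ.i≤j⇒0≤j-i (up 0 1 z≤n (s≤s z≤n))))
  where
  F : Series
  F = gap N B 1
  Δ₁ : Δ F 1 ≡ ℤ.-1ℤ
  Δ₁ = trans (Δ-gap N B 1 1) (cong₂ ℤ._-_ (Δ-gaussian₅-low N (ℕ.≤-trans (s≤s z≤n) 2≤N))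
    (trans (mono-⊛-+ 1 (Δ (gaussian 3 B)) 0) (Δ-gaussian₃-low B z≤n)))
  absurd : ¬ 0ℤ ℤ.≤ ℤ.-1ℤ
  absurd ()

-- Return to the original parameters.

-- The exponent in f5 uses truncated subtraction and halving; both are exact here.
shift-exponent : ∀ N B → 3 * (3 + B) + 16 ≤ 5 * (5 + N) → (3 + B) % 2 ≡ (5 + N) % 2 →
  2 * ⌊ (5 * (5 + N) ∸ 3 * (3 + B) ∸ 16) /2⌋ + 3 * B ≡ 5 * N
shift-exponent N B bound parity = ℕ.+-cancelʳ-≡ 25 _ _ (begin
  -- The constant 25 = 5·5 = 3·3 + 16 undoes the substitutions m = 5 + N and b = 3 + B.
  2 * ⌊ d /2⌋ + 3 * B + 25   ≡⟨ cong (λ x → x + 3 * B + 25) halving ⟩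
  d + 3 * B + 25             ≡⟨ regroup₁ d B ⟩
  3 * b + 16 + d             ≡⟨ exact ⟩
  5 * m                      ≡⟨ regroup₂ N ⟩
  5 * N + 25                 ∎)
  where
  open ≡-Reasoning
  m b d : ℕ
  m = 5 + N
  b = 3 + B
  d = 5 * m ∸ 3 * b ∸ 16
  regroup₁ : ∀ d B → d + 3 * B + 25 ≡ 3 * (3 + B) + 16 + d
  regroup₁ = solve-∀
  regroup₂ : ∀ N → 5 * (5 + N) ≡ 5 * N + 25
  regroup₂ = solve-∀
  exact : 3 * b + 16 + d ≡ 5 * m
  exact = trans (cong (3 * b + 16 +_) (ℕ.∸-+-assoc (5 * m) (3 * b) 16)) (ℕ.m+[n∸m]≡n bound)
  r β μ : ℕ
  r = m % 2
  β = b / 2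
  μ = m / 2
  b≡ : b ≡ r + β * 2
  b≡ = trans (ℕ.m≡m%n+[m/n]*n b 2) (cong (_+ β * 2) parity)
  m≡ : m ≡ r + μ * 2
  m≡ = ℕ.m≡m%n+[m/n]*n m 2
  -- With the common remainder r, both 3b + 16 and 5m are 3r plus an even number, so d is a
  -- difference of even numbers.
  even : 2 ∣ d
  even = ℕ.∣m+n∣m⇒∣n {2} {(3 * β + 8) * 2} {d} (divides (r + 5 * μ) (ℕ.+-cancelˡ-≡ (3 * r) _ _ (begin
    3 * r + ((3 * β + 8) * 2 + d)   ≡⟨ regroup₃ r β d ⟩
    3 * (r + β * 2) + 16 + d        ≡⟨ cong (λ x → 3 * x + 16 + d) b≡ ⟨
    3 * b + 16 + d                  ≡⟨ exact ⟩
    5 * m                           ≡⟨ cong (5 *_) m≡ ⟩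
    5 * (r + μ * 2)                 ≡⟨ regroup₄ r μ ⟩
    3 * r + (r + 5 * μ) * 2         ∎))) (divides (3 * β + 8) refl)
    where
    regroup₃ : ∀ r β d → 3 * r + ((3 * β + 8) * 2 + d) ≡ 3 * (r + β * 2) + 16 + d
    regroup₃ = solve-∀
    regroup₄ : ∀ r μ → 5 * (r + μ * 2) ≡ 3 * r + (r + 5 * μ) * 2
    regroup₄ = solve-∀
  double-half : ∀ e → 2 * ⌊ e * 2 /2⌋ ≡ e * 2
  double-half e = trans (ℕ.*-comm 2 ⌊ e * 2 /2⌋) (cong (_* 2) (trans (cong ⌊_/2⌋ (twice e)) (sym (ℕ.n≡⌊n+n/2⌋ e))))
    where
    twice : ∀ e → e * 2 ≡ e + e
    twice = solve-∀
  halving : 2 * ⌊ d /2⌋ ≡ d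
  halving = subst (λ d → 2 * ⌊ d /2⌋ ≡ d) (sym (ℕ._∣_.equality even)) (double-half (ℕ.quotient even))

⊖-shiftQ-cong : ∀ a a′ b b′ s → a ≈ a′ → b ≈ b′ → (a ⊖ shiftQ s b) ≈ (a′ ⊖ shiftQ s b′)
⊖-shiftQ-cong a a′ b b′ s a≈a′ b≈b′ = pointwise λ n → cong₂ ℤ._-_ (at a≈a′ n)
  (cong (λ x → if s ≤ᵇ n then x else 0ℤ) (at b≈b′ (n ∸ s)))

f5≈gap : ∀ N B → f5 (5 + N) (3 + B) ≈
  gap N B ⌊ (5 * (5 + N) ∸ 3 * (3 + B) ∸ 16) /2⌋
f5≈gap N B = ⊖-shiftQ-cong (qBinom (5 + N) 5) (gaussian 5 N) (qBinom (3 + B) 3) (gaussian 3 B)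
  ⌊ (5 * (5 + N) ∸ 3 * (3 + B) ∸ 16) /2⌋ (qBinom≈gaussian 5 N) (qBinom≈gaussian 3 B)

nonnegative-≈ : ∀ {a b} → a ≈ b → Nonnegative b → Nonnegative a
nonnegative-≈ a≈b b≥0 n = ℤ.≤-trans (b≥0 n) (ℤ.≤-reflexive (sym (at a≈b n)))

unimodal-≈ : ∀ {a b} → a ≈ b → Unimodal b → Unimodal a
unimodal-≈ a≈b (t , up , down) = t ,
  (λ i j i≤j j≤t → subst₂ ℤ._≤_ (sym (at a≈b i)) (sym (at a≈b j)) (up i j i≤j j≤t)) ,
  (λ i j t≤i i≤j → subst₂ ℤ._≤_ (sym (at a≈b j)) (sym (at a≈b i)) (down i j t≤i i≤j))

-- The exceptional equation says 5m - 3b - 16 = 2, and s is half of the left side.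
exceptional⇔ : ∀ N B s → 2 * s + 3 * B ≡ 5 * N →
  (s ≡ 1 → 3 * (3 + B) + 18 ≡ 5 * (5 + N)) × (3 * (3 + B) + 18 ≡ 5 * (5 + N) → s ≡ 1)
exceptional⇔ N B s 2s+3B≡5N =
  (λ { refl → trans (regroup₁ B) (trans (cong (25 +_) 2s+3B≡5N) (sym (regroup₂ N))) }) ,
  (λ eq → ℕ.*-cancelˡ-≡ s 1 2 (ℕ.+-cancelʳ-≡ (3 * B) _ _ (trans 2s+3B≡5N
    (ℕ.+-cancelˡ-≡ 25 _ _ (trans (sym (regroup₂ N)) (trans (sym eq) (regroup₁ B)))))))
  where
  regroup₁ : ∀ B → 3 * (3 + B) + 18 ≡ 25 + (2 + 3 * B)
  regroup₁ = solve-∀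
  regroup₂ : ∀ N → 5 * (5 + N) ≡ 25 + 5 * N
  regroup₂ = solve-∀

gap-classification : ∀ N B s (F : Series) → 1000 ≤ N → 2 * s + 3 * B ≡ 5 * N → F ≈ gap N B s →
  (3 * (3 + B) + 18 ≢ 5 * (5 + N) → Nonnegative F × Unimodal F) ×
  (3 * (3 + B) + 18 ≡ 5 * (5 + N) → ¬ (Nonnegative F × Unimodal F))
gap-classification N B s F 1000≤N 2s+3B≡5N F≈gap = regular , exceptional
  where
  regular : 3 * (3 + B) + 18 ≢ 5 * (5 + N) → Nonnegative F × Unimodal F
  regular ≢ = nonnegative-≈ F≈gap (palindromic-nonnegative pal Δ≥0) , unimodal-≈ F≈gap (palindromic-unimodal pal Δ≥0)
    where
    pal : Palindromic (5 * N) (gap N B s)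
    pal = gap-palindromic N B s 2s+3B≡5N
    Δ≥0 : ∀ n → 2 * n ≤ 5 * N → 0ℤ ℤ.≤ Δ (gap N B s) n
    Δ≥0 = Δ-gap-nonneg N B s 1000≤N 2s+3B≡5N (λ s≡1 → ≢ (proj₁ (exceptional⇔ N B s 2s+3B≡5N) s≡1))
  -- For B = 0 the equation would read 2 = 5N.
  positive : ∀ B → 2 + 3 * B ≡ 5 * N → 1 ≤ B
  positive (suc _) _    = s≤s z≤n
  positive zero    2≡5N with ℕ.≤-trans (ℕ.*-monoʳ-≤ 5 1000≤N) (ℕ.≤-reflexive (sym 2≡5N))
  ... | s≤s (s≤s ())
  exceptional : 3 * (3 + B) + 18 ≡ 5 * (5 + N) → ¬ (Nonnegative F × Unimodal F)
  exceptional eq (_ , unimodal) = gap-nonunimodal N B (ℕ.≤-trans (ℕ.m≤m+n 2 998) 1000≤N)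
    (positive B (subst (λ s → 2 * s + 3 * B ≡ 5 * N) s≡1 2s+3B≡5N))
    (subst (λ s → Unimodal (gap N B s)) s≡1 (unimodal-≈ (≈-sym F≈gap) unimodal))
    where
    s≡1 : s ≡ 1
    s≡1 = proj₂ (exceptional⇔ N B s 2s+3B≡5N) eq

theorem2p4 : ∃ λ M → ∀ m → M ≤ m → 5 ≤ m →
    ∀ b → 3 ≤ b → 3 * b + 16 ≤ 5 * m → b % 2 ≡ m % 2 →
    (3 * b + 18 ≢ 5 * m → Nonnegative (f5 m b) × Unimodal (f5 m b)) ×
    (3 * b + 18 ≡ 5 * m → ¬ (Nonnegative (f5 m b) × Unimodal (f5 m b)))
-- The threshold 1000 for N = m - 5, restated for m.
theorem2p4 = 1005 , λ m 1005≤m 5≤m b 3≤b → go m b 1005≤m (ℕ.m≤n⇒∃[o]m+o≡n 5≤m) (ℕ.m≤n⇒∃[o]m+o≡n 3≤b)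
  where
  go : ∀ m b → 1005 ≤ m → (∃ λ N → 5 + N ≡ m) → (∃ λ B → 3 + B ≡ b) →
    3 * b + 16 ≤ 5 * m → b % 2 ≡ m % 2 →
    (3 * b + 18 ≢ 5 * m → Nonnegative (f5 m b) × Unimodal (f5 m b)) ×
    (3 * b + 18 ≡ 5 * m → ¬ (Nonnegative (f5 m b) × Unimodal (f5 m b)))
  go _ _ 1005≤m (N , refl) (B , refl) bound parity = gap-classification N B
    ⌊ (5 * (5 + N) ∸ 3 * (3 + B) ∸ 16) /2⌋ (f5 (5 + N) (3 + B))
    (ℕ.+-cancelˡ-≤ 5 1000 N 1005≤m) (shift-exponent N B bound parity) (f5≈gap N B)
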